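{- For every integer $d\geq 1$ and every real $0<\epsilon\leq 1$, there is an adaptive two-sided error testing algorithm for the property "binary rank at most $d$" with query complexity $O\left(\frac{d^3\log(d+1)}{\epsilon^2}\right)$. That is, there is a randomized algorithm which, given query access to the entries of a $0,1$ matrix $M$ of size $n\times m$ (for any $n,m\ge 1$) together with $d$ and $\epsilon$, makes $O(d^3\log(d+1)/\epsilon^2)$ queries to entries of $M$ (with an absolute implied constant, independent of $n,m,d,\epsilon,M$), and satisfies: if $\operatorname{rank}_{\mathrm{bin}}(M)\leq d$ then it accepts with probability at least $2/3$; and if $M$ is $\epsilon$-far from binary rank at most $d$ then it rejects with probability at least $2/3$.
   Context: The binary rank $\operatorname{rank}_{\mathrm{bin}}(M)$ of a $0,1$ matrix $M$ of size $n\times m$ is the minimal $d$ for which there exist $0,1$ matrices $A$ and $B$ of sizes $n\times d$ and $d\times m$, respectively, such that $M=A\cdot B$, where the operations are over the integers. The distance between two $0,1$ matrices $M,M'$ of size $n\times m$ is $\operatorname{dist}(M,M')=\frac{|\{(i,j) : M_{i,j}\neq M'_{i,j}\}|}{n\cdot m}$. The matrix $M$ is $\epsilon$-far from binary rank at most $d$ if $\operatorname{dist}(M,M')\geq\epsilon$ for every $0,1$ matrix $M'$ of size $n\times m$ with $\operatorname{rank}_{\mathrm{bin}}(M')\leq d$. The query complexity of an algorithm is the number of entries of $M$ which it queries. An algorithm is adaptive if its queries may depend on the answers to previous queries (as well as on the input parameters and its random coin tosses). "Two-sided error" means that the algorithm may err with probability at most $1/3$ both on matrices of binary rank at most $d$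 and on matrices that are $\epsilon$-far from binary rank at most $d$. -}

module Defs where

open import Data.Bool.Base using (Bool; true; false; if_then_else_)
import Data.Bool.Properties as Bool
open import Data.Digit using (Bit)
open import Data.Fin.Base using (Fin; toℕ)
import Data.Fin.Properties as Fin
open import Data.Integer.Base as ℤ using (ℤ; +_)
import Data.Integer.Properties as ℤ
open import Data.List.Base using (List; allFin; cartesianProduct; filter; length)
open import Data.Nat.Base as ℕ using (ℕ; suc; NonZero; _⊔_)
import Data.Nat.Properties as ℕ
open import Data.Product.Base using (_×_; _,_; ∃-syntax)
open import Data.Rational.Base as ℚ using (ℚ; 0ℚ; 1ℚ; _/_)
import Data.Rational.Properties as ℚ
open import Data.Sum.Base using (_⊎_)
open import Data.Vec.Functional using (foldr)
open import Function.Bundles using (_⇔_)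
open import Relation.Binary.PropositionalEquality using (_≡_)
open import Relation.Nullary using (¬_; does; ¬?)

import Algebra.Properties.CommutativeMonoid.Sum ℤ.+-0-commutativeMonoid as ℤSum
import Algebra.Properties.CommutativeMonoid.Sum ℚ.+-0-commutativeMonoid as ℚSum

-- Two-sided Dedekind reals: L q means q < x, and U q means x < q.
record ℝ : Set₁ where
  field
    L U         : ℚ → Set
    L-inhabited : ∃[ q ] L q
    U-inhabited : ∃[ q ] U q
    L-rounded   : ∀ p → L p ⇔ (∃[ q ] (p ℚ.< q × L q))
    U-rounded   : ∀ q → U q ⇔ (∃[ p ] (p ℚ.< q × U p))
    disjoint    : ∀ q → ¬ (L q × U q)
    located     : ∀ p q → p ℚ.< q → L p ⊎ U q

_ℚ<ℝ_ : ℚ → ℝ → Set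
q ℚ<ℝ x = ℝ.L x q

_ℝ≤ℚ_ : ℝ → ℚ → Set
x ℝ≤ℚ q = ¬ (q ℚ<ℝ x)

-- For ε > 0, this says a ≤ b / ε², that is, a · ε² ≤ b.  Since a is a natural
-- number, a · ε² is the supremum of a · r² over the rationals 0 < r < ε.
_≤_/[_]² : ℕ → ℕ → ℝ → Set
a ≤ b /[ ε ]² =
  ∀ r → 0ℚ ℚ.< r → r ℚ<ℝ ε → (+ a / 1) ℚ.* (r ℚ.* r) ℚ.≤ (+ b / 1)

Matrix : ℕ → ℕ → Set
Matrix n m = Fin n → Fin m → Bit

toℤ : Bit → ℤ
toℤ b = + toℕ b

Factorization : ∀ {n m} → Matrix n m → ℕ → Set
Factorization {n} {m} M d =
  ∃[ A ] ∃[ B ] IsProduct A B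
  where
  IsProduct : Matrix n d → Matrix d m → Set
  IsProduct A B =
    ∀ i j → toℤ (M i j) ≡ ℤSum.sum (λ k → toℤ (A i k) ℤ.* toℤ (B k j))

IsBinaryRank : ∀ {n m} → Matrix n m → ℕ → Set
IsBinaryRank M r = Factorization M r × (∀ d → Factorization M d → r ℕ.≤ d)

BinaryRankAtMost : ∀ {n m} → ℕ → Matrix n m → Set
BinaryRankAtMost d M = ∃[ r ] (IsBinaryRank M r × r ℕ.≤ d)

differences : ∀ {n m} → Matrix n m → Matrix n m → List (Fin n × Fin m)
differences {n} {m} M M′ =
  filter (λ (i , j) → ¬? (M i j Fin.≟ M′ i j))
         (cartesianProduct (allFin n) (allFin m))

dist : ∀ {n m} .{{_ : NonZero n}} .{{_ : NonZero m}} →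
       Matrix n m → Matrix n m → ℚ
dist {n} {m} M M′ = _/_ (+ length (differences M M′)) (n ℕ.* m) {{ℕ.m*n≢0 n m}}

_IsFarFromBinaryRankAtMost_[_] :
  ∀ {n m} .{{_ : NonZero n}} .{{_ : NonZero m}} → Matrix n m → ℕ → ℝ → Set
_IsFarFromBinaryRankAtMost_[_] {n} {m} M d ε =
  ∀ (M′ : Matrix n m) → BinaryRankAtMost d M′ → ε ℝ≤ℚ dist M M′

-- An adaptive randomized algorithm with query access to an n × m matrix.  A run
-- descends the tree; the leaf `output true` accepts and `output false` rejects.
-- `toss k` is one uniform draw from Fin k, so a fair coin is `toss 2`.
data Algorithm (n m : ℕ) : Set where
  output : Bool → Algorithm n m
  query  : Fin n → Fin m → (Bit → Algorithm n m) → Algorithm n m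
  toss   : (k : ℕ) .{{_ : NonZero k}} → (Fin k → Algorithm n m) → Algorithm n m

module _ {n m : ℕ} where

  -- The probability that the run on M outputs b.
  Pr[_on_outputs_] : Algorithm n m → Matrix n m → Bool → ℚ
  Pr[ output b′   on M outputs b ] = if does (b′ Bool.≟ b) then 1ℚ else 0ℚ
  Pr[ query i j f on M outputs b ] = Pr[ f (M i j) on M outputs b ]
  Pr[ toss k f    on M outputs b ] =
    (+ 1 / k) ℚ.* ℚSum.sum (λ c → Pr[ f c on M outputs b ])

  -- Worst case over the tosses; a repeated query is counted every time.
  queries : Algorithm n m → Matrix n m → ℕ
  queries (output b)    M = 0
  queries (query i j f) M = suc (queries (f (M i j)) M)
  queries (toss k f)    M = foldr _⊔_ 0 (λ c → queries (f c) M)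

  Pr[_accepts_] Pr[_rejects_] : Algorithm n m → Matrix n m → ℚ
  Pr[ T accepts M ] = Pr[ T on M outputs true ]
  Pr[ T rejects M ] = Pr[ T on M outputs false ]

{-# OPTIONS --safe #-}
-- Over 𝔽₂, a matrix M = A B of binary rank at most d has rank at most d.  Gaussian
-- elimination with randomly found pivots therefore stops within d steps, and when it is
-- interrupted at a random one of O(d²/ε²) rounds, the residual of M is expected to be
-- nonzero only at an O(ε²/d) fraction of the positions.  The pivots give every row and
-- every column a type of at most d bits, known after at most d queries, and the inner
-- product of the two types predicts the entry.
--
-- Most entries of M are then those of a factorization which depends on the types only
-- and is described by O(d²) bits.  Choose d columns on which the prediction is good and
-- whose columns in B span, over ℤ, those of all good columns.  Any row vector with the
-- right products with these d columns, which the type of the row tells, is as good as the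
-- row of A.  The same argument for the rows replaces the columns of B.  A graph on the d
-- inner indices keeps the entries of the product in {0 , 1}.
--
-- It remains to check the 2^O(d²) candidates against one sample of O(d²/ε) positions.
-- If M is ε-far, every candidate errs with probability at least ε, and a union bound
-- over an exponential tail estimate rejects all of them.
module Submission where

open import Defs
open import Data.Bool.Base using (Bool; true; false; not; _∧_; _xor_; if_then_else_)
import Data.Bool.Properties as Bool
open import Data.Empty using (⊥-elim)
open import Data.Fin.Base using (Fin; zero; suc; toℕ; fromℕ<)
import Data.Fin.Properties as Fin
open import Data.Integer.Base as ℤ using (ℤ; +_)
import Data.Integer.Properties as ℤ
open import Data.List.Base as List using (List; []; _∷_; _++_; allFin; cartesianProduct; filter; length; map; tabulate)
import Data.List.Properties as List
open import Data.List.Membership.Propositional using (_∈_; find; lose)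
import Data.List.Membership.Propositional.Properties as ∈
open import Data.List.Relation.Unary.Any as Any using (here; there; any?; satisfied)
import Data.List.Relation.Unary.Any.Properties as Any
open import Data.Maybe.Base using (Maybe; just; nothing)
open import Data.Nat.Base as ℕ using (ℕ; zero; suc; NonZero; _+_; _*_; _^_; _≤_; z≤n; s≤s)
open import Data.Nat.Logarithm using (⌊log₂_⌋; ⌊log₂⌋-mono-≤; ⌊log₂[2^n]⌋≡n)
import Data.Nat.Properties as ℕ
open import Data.Product.Base using (Σ-syntax; ∃-syntax; _×_; _,_; proj₁; proj₂)
open import Data.Rational.Base as ℚ using (ℚ; 0ℚ; 1ℚ; _/_) renaming (_≤_ to _ℚ≤_)
import Data.Rational.Properties as ℚ
open import Data.Sum.Base using (_⊎_; inj₁; inj₂)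
open import Data.Digit using (Bit)
open import Data.Vec.Functional using (foldr)
open import Data.Vec.Base as Vec using (Vec; []; _∷_; lookup)
import Data.Vec.Properties as Vec
open import Function.Base using (_∘_; id; it)
open import Function.Bundles using (Equivalence)
open import Data.Nat.Induction using (<-rec)
open import Relation.Binary.PropositionalEquality
open import Relation.Nullary
open import Relation.Nullary.Decidable using (dec-true)
open import Relation.Unary using (Decidable)
import Algebra.Properties.CommutativeMonoid.Sum ℤ.+-0-commutativeMonoid as ℤSum
open import Algebra.Bundles using (CommutativeRing)
open import Data.Rational.Solver using (module +-*-Solver)
import Data.Bool.Solver as BoolSolver
import Data.Integer.Solver as ℤSolver
open import Data.Nat.Solver using () renaming (module +-*-Solver to NatSolver)
open +-*-Solver using (solve; _:+_; _:*_; _:-_; :-_; _:=_; con)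
import Algebra.Properties.Semiring.Sum (CommutativeRing.semiring ℚ.+-*-commutativeRing) as ℚSum
import Algebra.Properties.Semiring.Mult (CommutativeRing.semiring ℚ.+-*-commutativeRing) as Mult
import Algebra.Properties.Semiring.Exp (CommutativeRing.semiring ℚ.+-*-commutativeRing) as Exp
import Data.Rational.Unnormalised.Base as ℚᵘ
import Data.Rational.Unnormalised.Properties as ℚᵘ

-- Averages

-- Recursion on `n` supplies the semiring laws and makes induction easy, which `+ n / 1` does not;
-- `/1≡ι` translates between the two.
ι : ℕ → ℚ
ι n = n Mult.× 1ℚ

ι-+ : ∀ m n → ι (m + n) ≡ ι m ℚ.+ ι n
ι-+ = Mult.×-homo-+ 1ℚ

ι-* : ∀ m n → ι (m * n) ≡ ι m ℚ.* ι n
ι-* = Mult.×1-homo-*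

ι≥0 : ∀ n → 0ℚ ℚ.≤ ι n
ι≥0 zero    = ℚ.≤-refl
ι≥0 (suc n) = ℚ.+-mono-≤ {0ℚ} {1ℚ} (ℚ.nonNegative⁻¹ 1ℚ) (ι≥0 n)

ι-mono : ∀ {m n} → m ≤ n → ι m ℚ.≤ ι n
ι-mono {n = n} z≤n = ι≥0 n
ι-mono (s≤s m≤n)   = ℚ.+-monoʳ-≤ 1ℚ (ι-mono m≤n)

ι-positive : ∀ n .{{_ : NonZero n}} → ℚ.Positive (ι n)
ι-positive (suc n) = ℚ.pos+nonNeg⇒pos 1ℚ (ι n) {{ℚ.nonNegative (ι≥0 n)}}

toℚᵘ-/ : ∀ p k → ℚ.toℚᵘ (p / suc k) ℚᵘ.≃ ℚᵘ.mkℚᵘ p k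
toℚᵘ-/ p k = ℚ.toℚᵘ-fromℚᵘ (ℚᵘ.mkℚᵘ p k)

/1≡ι : ∀ n → + n / 1 ≡ ι n
/1≡ι zero    = refl
/1≡ι (suc n) = trans (ℚ.toℚᵘ-injective step) (cong (1ℚ ℚ.+_) (/1≡ι n))
  where
  step : ℚ.toℚᵘ (+ suc n / 1) ℚᵘ.≃ ℚ.toℚᵘ (1ℚ ℚ.+ + n / 1)
  step = ℚᵘ.≃-trans (toℚᵘ-/ (+ suc n) 0)
    (ℚᵘ.≃-trans (ℚᵘ.*≡* (cong (ℤ._* + 1) (cong (ℤ._+_ (+ 1)) (sym (ℤ.*-identityʳ (+ n))))))
    (ℚᵘ.≃-sym (ℚᵘ.≃-trans (ℚ.toℚᵘ-homo-+ 1ℚ (+ n / 1))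
      (ℚᵘ.+-congʳ (ℚ.toℚᵘ 1ℚ) (toℚᵘ-/ (+ n) 0)))))

/-*-ι : ∀ p k .{{_ : NonZero k}} → (p / k) ℚ.* ι k ≡ p / 1
/-*-ι p k@(suc k-1) = trans (cong ((p / k) ℚ.*_) (sym (/1≡ι k))) (ℚ.toℚᵘ-injective
  (ℚᵘ.≃-trans (ℚ.toℚᵘ-homo-* (p / k) (+ k / 1))
  (ℚᵘ.≃-trans (ℚᵘ.*-cong (toℚᵘ-/ p k-1) (toℚᵘ-/ (+ k) 0))
  (ℚᵘ.≃-trans (ℚᵘ.*≡* (trans (ℤ.*-identityʳ (p ℤ.* + k)) (cong (p ℤ.*_) (cong +_ (sym (ℕ.*-identityʳ k))))))
  (ℚᵘ.≃-sym (toℚᵘ-/ p 0))))))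

≡-≤-trans : ∀ {p q r} → p ≡ q → q ℚ.≤ r → p ℚ.≤ r
≡-≤-trans refl q≤r = q≤r

≤-≡-trans : ∀ {p q r} → p ℚ.≤ q → q ≡ r → p ℚ.≤ r
≤-≡-trans p≤q refl = p≤q

*-mono-≤ : ∀ {c p q} → 0ℚ ℚ.≤ c → p ℚ.≤ q → c ℚ.* p ℚ.≤ c ℚ.* q
*-mono-≤ {c} 0≤c = ℚ.*-monoˡ-≤-nonNeg c {{ℚ.nonNegative 0≤c}}

*-nonNeg : ∀ {p q} → 0ℚ ℚ.≤ p → 0ℚ ℚ.≤ q → 0ℚ ℚ.≤ p ℚ.* q
*-nonNeg {p} 0≤p 0≤q = ≡-≤-trans (sym (ℚ.*-zeroʳ p)) (*-mono-≤ 0≤p 0≤q)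

*-mono₂-≤ : ∀ {p q r s} → 0ℚ ℚ.≤ p → 0ℚ ℚ.≤ s → p ℚ.≤ q → r ℚ.≤ s → p ℚ.* r ℚ.≤ q ℚ.* s
*-mono₂-≤ {p} {q} {r} {s} 0≤p 0≤s p≤q r≤s =
  ℚ.≤-trans (*-mono-≤ 0≤p r≤s) (ℚ.*-monoʳ-≤-nonNeg s {{ℚ.nonNegative 0≤s}} p≤q)

+-nonNeg : ∀ {p q} → 0ℚ ℚ.≤ p → 0ℚ ℚ.≤ q → 0ℚ ℚ.≤ p ℚ.+ q
+-nonNeg = ℚ.+-mono-≤

^-nonNeg : ∀ {p} n → 0ℚ ℚ.≤ p → 0ℚ ℚ.≤ p Exp.^ n
^-nonNeg zero    0≤p = ℚ.nonNegative⁻¹ 1ℚ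
^-nonNeg (suc n) 0≤p = *-nonNeg 0≤p (^-nonNeg n 0≤p)

sum-mono : ∀ {k} {f g : Fin k → ℚ} → (∀ i → f i ℚ.≤ g i) → ℚSum.sum f ℚ.≤ ℚSum.sum g
sum-mono {zero}  f≤g = ℚ.≤-refl
sum-mono {suc k} f≤g = ℚ.+-mono-≤ (f≤g zero) (sum-mono (f≤g ∘ suc))

sum-const : ∀ k c → ℚSum.sum {k} (λ _ → c) ≡ ι k ℚ.* c
sum-const zero    c = sym (ℚ.*-zeroˡ c)
sum-const (suc k) c = trans (cong (c ℚ.+_) (sum-const k c))
  (solve 2 (λ c k → c :+ k :* c := (con 1ℚ :+ k) :* c) refl c (ι k))

sum-nonNeg : ∀ {k} (f : Fin k → ℚ) → (∀ i → 0ℚ ℚ.≤ f i) → 0ℚ ℚ.≤ ℚSum.sum f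
sum-nonNeg {zero}  f 0≤f = ℚ.≤-refl
sum-nonNeg {suc k} f 0≤f = +-nonNeg (0≤f zero) (sum-nonNeg (f ∘ suc) (0≤f ∘ suc))

term≤sum : ∀ {k} (f : Fin k → ℚ) → (∀ i → 0ℚ ℚ.≤ f i) → ∀ i → f i ℚ.≤ ℚSum.sum f
term≤sum {suc k} f 0≤f zero = ≡-≤-trans (sym (ℚ.+-identityʳ (f zero)))
  (ℚ.+-monoʳ-≤ (f zero) (sum-nonNeg (f ∘ suc) (0≤f ∘ suc)))
term≤sum {suc k} f 0≤f (suc i) = ≡-≤-trans (sym (ℚ.+-identityˡ (f (suc i))))
  (ℚ.+-mono-≤ (0≤f zero) (term≤sum (f ∘ suc) (0≤f ∘ suc) i))

opaque
  -- The expression that defines the probability after a `toss`. It is opaque: `Pr-toss` makes the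
  -- link, and all later arguments rest on the laws of averages.
  avg : ∀ k .{{_ : NonZero k}} → (Fin k → ℚ) → ℚ
  avg k f = (+ 1 / k) ℚ.* ℚSum.sum f

1/≥0 : ∀ k .{{_ : NonZero k}} → 0ℚ ℚ.≤ + 1 / k
1/≥0 k = ℚ.nonNegative⁻¹ (+ 1 / k) {{ℚ.normalize-nonNeg 1 k}}

module _ {k : ℕ} .{{_ : NonZero k}} where

  opaque
    unfolding avg

    avg-cong : ∀ {f g : Fin k → ℚ} → (∀ i → f i ≡ g i) → avg k f ≡ avg k g
    avg-cong f≗g = cong ((+ 1 / k) ℚ.*_) (ℚSum.sum-cong-≗ f≗g)

    avg-mono : ∀ {f g : Fin k → ℚ} → (∀ i → f i ℚ.≤ g i) → avg k f ℚ.≤ avg k g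
    avg-mono f≤g = *-mono-≤ (1/≥0 k) (sum-mono f≤g)

    avg-+ : ∀ (f g : Fin k → ℚ) → avg k (λ i → f i ℚ.+ g i) ≡ avg k f ℚ.+ avg k g
    avg-+ f g = trans (cong ((+ 1 / k) ℚ.*_) (ℚSum.∑-distrib-+ f g)) (ℚ.*-distribˡ-+ (+ 1 / k) _ _)

    avg-* : ∀ c (f : Fin k → ℚ) → avg k (λ i → c ℚ.* f i) ≡ c ℚ.* avg k f
    avg-* c f = trans (cong ((+ 1 / k) ℚ.*_) (sym (ℚSum.*-distribˡ-sum c f)))
      (solve 3 (λ a c s → a :* (c :* s) := c :* (a :* s)) refl (+ 1 / k) c (ℚSum.sum f))

    ι-*-avg : ∀ (f : Fin k → ℚ) → ι k ℚ.* avg k f ≡ ℚSum.sum f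
    ι-*-avg f = trans (solve 3 (λ k a s → k :* (a :* s) := (a :* k) :* s) refl (ι k) (+ 1 / k) (ℚSum.sum f))
      (trans (cong (ℚ._* ℚSum.sum f) (/-*-ι (+ 1) k)) (ℚ.*-identityˡ _))

    avg-const : ∀ c → avg k (λ _ → c) ≡ c
    avg-const c = trans (cong ((+ 1 / k) ℚ.*_) (sum-const k c))
      (trans (sym (ℚ.*-assoc (+ 1 / k) (ι k) c)) (trans (cong (ℚ._* c) (/-*-ι (+ 1) k)) (ℚ.*-identityˡ c)))

    avg-≤ : ∀ {f : Fin k → ℚ} {c} → (∀ i → f i ℚ.≤ c) → avg k f ℚ.≤ c
    avg-≤ {c = c} f≤c = ≤-≡-trans (avg-mono f≤c) (avg-const c)

    avg-nonNeg : ∀ {f : Fin k → ℚ} → (∀ i → 0ℚ ℚ.≤ f i) → 0ℚ ℚ.≤ avg k f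
    avg-nonNeg 0≤f = ≡-≤-trans (sym (avg-const 0ℚ)) (avg-mono 0≤f)

    avg-sum : ∀ {l} (f : Fin k → Fin l → ℚ) →
              avg k (λ i → ℚSum.sum (f i)) ≡ ℚSum.sum (λ j → avg k (λ i → f i j))
    avg-sum f = trans (cong ((+ 1 / k) ℚ.*_) (ℚSum.∑-comm f)) (ℚSum.*-distribˡ-sum (+ 1 / k) (λ j → ℚSum.sum (λ i → f i j)))

opaque
  unfolding avg

  avg-comm : ∀ {k l} .{{_ : NonZero k}} .{{_ : NonZero l}} (f : Fin k → Fin l → ℚ) →
             avg k (λ i → avg l (f i)) ≡ avg l (λ j → avg k (λ i → f i j))
  avg-comm {k} {l} f = trans (avg-* (+ 1 / l) (λ i → ℚSum.sum (f i))) (cong ((+ 1 / l) ℚ.*_) (avg-sum f))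

module _ {n m : ℕ} .{{_ : NonZero n}} .{{_ : NonZero m}} where

  avg₂ : (Fin n → Fin m → ℚ) → ℚ
  avg₂ f = avg n λ i → avg m (f i)

  avg₂-cong : ∀ {f g : Fin n → Fin m → ℚ} → (∀ i j → f i j ≡ g i j) → avg₂ f ≡ avg₂ g
  avg₂-cong f≗g = avg-cong λ i → avg-cong (f≗g i)

  avg₂-mono : ∀ {f g : Fin n → Fin m → ℚ} → (∀ i j → f i j ℚ.≤ g i j) → avg₂ f ℚ.≤ avg₂ g
  avg₂-mono f≤g = avg-mono λ i → avg-mono (f≤g i)

  avg₂-+ : ∀ (f g : Fin n → Fin m → ℚ) → avg₂ (λ i j → f i j ℚ.+ g i j) ≡ avg₂ f ℚ.+ avg₂ g
  avg₂-+ f g = trans (avg-cong λ i → avg-+ (f i) (g i)) (avg-+ (λ i → avg m (f i)) (λ i → avg m (g i)))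

  avg₂-* : ∀ c (f : Fin n → Fin m → ℚ) → avg₂ (λ i j → c ℚ.* f i j) ≡ c ℚ.* avg₂ f
  avg₂-* c f = trans (avg-cong λ i → avg-* c (f i)) (avg-* c (λ i → avg m (f i)))

  avg₂-const : ∀ c → avg₂ (λ _ _ → c) ≡ c
  avg₂-const c = trans (avg-cong {n} λ _ → avg-const {m} c) (avg-const {n} c)

  avg₂-sum : ∀ {l} (f : Fin n → Fin m → Fin l → ℚ) →
             avg₂ (λ i j → ℚSum.sum (f i j)) ≡ ℚSum.sum (λ k → avg₂ (λ i j → f i j k))
  avg₂-sum f = trans (avg-cong λ i → avg-sum (f i)) (avg-sum λ i k → avg m (λ j → f i j k))

𝟙 : Bool → ℚ
𝟙 b = if b then 1ℚ else 0ℚ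

0≤1 : 0ℚ ℚ.≤ 1ℚ
0≤1 = ℚ.nonNegative⁻¹ 1ℚ

𝟙≥0 : ∀ b → 0ℚ ℚ.≤ 𝟙 b
𝟙≥0 true  = 0≤1
𝟙≥0 false = ℚ.≤-refl

𝟙≤1 : ∀ b → 𝟙 b ℚ.≤ 1ℚ
𝟙≤1 true  = ℚ.≤-refl
𝟙≤1 false = 0≤1

𝟙-does-mono : ∀ {P Q : Set} (P? : Dec P) (Q? : Dec Q) → (P → Q) → 𝟙 (does P?) ℚ.≤ 𝟙 (does Q?)
𝟙-does-mono (no _)  Q?      _   = 𝟙≥0 (does Q?)
𝟙-does-mono (yes p) (yes q) _   = ℚ.≤-refl
𝟙-does-mono (yes p) (no ¬q) P⇒Q = contradiction (P⇒Q p) ¬q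

-- The tester

toBool : Bit → Bool
toBool zero       = false
toBool (suc zero) = true

entry : ∀ {n m} → Matrix n m → Fin n → Fin m → Bool
entry M i j = toBool (M i j)

infix 7 _⊙_
_⊙_ : ∀ {r} → Vec Bool r → Vec Bool r → Bool
[]       ⊙ []       = false
(a ∷ as) ⊙ (b ∷ bs) = (a ∧ b) xor as ⊙ bs

-- The pivots (i , j) of a Gaussian elimination over 𝔽₂.  Along with each pivot, the
-- types of its row and column at the time of its choice are kept, so that the type
-- of any row or column is found with one query per pivot.
data State (n m : ℕ) : ℕ → Set where
  initial : State n m 0
  pivot : ∀ {r} → Fin n → Fin m → Vec Bool r → Vec Bool r → State n m r → State n m (suc r)

Observation : ℕ → Set
Observation r = Vec Bool r × Vec Bool r × Bool

module _ {n m : ℕ} where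

  module _ (M : Matrix n m) where

    -- When `v` is the column type of `j₀`, the new bit is the residual of the earlier state at
    -- `(i , j₀)`. A pivot thus subtracts the product of its residual column and its residual row.
    rowType : ∀ {r} → State n m r → Fin n → Vec Bool r
    rowType initial                _ = []
    rowType (pivot _ j₀ _ v st) i = (entry M i j₀ xor rowType st i ⊙ v) ∷ rowType st i

    colType : ∀ {r} → State n m r → Fin m → Vec Bool r
    colType initial                _ = []
    colType (pivot i₀ _ u _ st) j = (entry M i₀ j xor u ⊙ colType st j) ∷ colType st j

    residual : ∀ {r} → State n m r → Fin n → Fin m → Bool
    residual st i j = entry M i j xor rowType st i ⊙ colType st j

  queryRowType : ∀ {r} → State n m r → Fin n → (Vec Bool r → Algorithm n m) → Algorithm n m
  queryRowType initial               i k = k []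
  queryRowType (pivot _ j₀ _ v st) i k =
    queryRowType st i λ x → query i j₀ λ b → k ((toBool b xor x ⊙ v) ∷ x)

  queryColType : ∀ {r} → State n m r → Fin m → (Vec Bool r → Algorithm n m) → Algorithm n m
  queryColType initial               j k = k []
  queryColType (pivot i₀ _ u _ st) j k =
    queryColType st j λ y → query i₀ j λ b → k ((toBool b xor u ⊙ y) ∷ y)

  queryPoint : ∀ {r} → State n m r → Fin n → Fin m → (Observation r → Algorithm n m) → Algorithm n m
  queryPoint st i j k = queryRowType st i λ x → queryColType st j λ y → query i j λ b → k (x , y , toBool b)

  observe : ∀ {r} → Matrix n m → State n m r → Fin n → Fin m → Observation r
  observe M st i j = rowType M st i , colType M st j , entry M i j

  module _ (M : Matrix n m) (b : Bool) where

    Pr-queryRowType : ∀ {r} (st : State n m r) i k →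
      Pr[ queryRowType st i k on M outputs b ] ≡ Pr[ k (rowType M st i) on M outputs b ]
    Pr-queryRowType initial             i k = refl
    Pr-queryRowType (pivot _ _ _ _ st) i k = Pr-queryRowType st i _

    Pr-queryColType : ∀ {r} (st : State n m r) j k →
      Pr[ queryColType st j k on M outputs b ] ≡ Pr[ k (colType M st j) on M outputs b ]
    Pr-queryColType initial             j k = refl
    Pr-queryColType (pivot _ _ _ _ st) j k = Pr-queryColType st j _

    Pr-queryPoint : ∀ {r} (st : State n m r) i j k →
      Pr[ queryPoint st i j k on M outputs b ] ≡ Pr[ k (observe M st i j) on M outputs b ]
    Pr-queryPoint st i j k = trans (Pr-queryRowType st i _) (Pr-queryColType st j _)

  module _ (M : Matrix n m) where

    queries-queryRowType : ∀ {r} (st : State n m r) i k →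
      queries (queryRowType st i k) M ≡ r + queries (k (rowType M st i)) M
    queries-queryRowType initial                i k = refl
    queries-queryRowType (pivot _ _ _ _ st) i k = trans (queries-queryRowType st i _) (ℕ.+-suc _ _)

    queries-queryColType : ∀ {r} (st : State n m r) j k →
      queries (queryColType st j k) M ≡ r + queries (k (colType M st j)) M
    queries-queryColType initial                j k = refl
    queries-queryColType (pivot _ _ _ _ st) j k = trans (queries-queryColType st j _) (ℕ.+-suc _ _)

    queries-queryPoint : ∀ {r} (st : State n m r) i j k →
      queries (queryPoint st i j k) M ≡ r + (r + suc (queries (k (observe M st i j)) M))
    queries-queryPoint {r} st i j k =
      trans (queries-queryRowType st i _) (cong (λ q → r + q) (queries-queryColType st j _))

    queries-toss : ∀ k .{{_ : NonZero k}} (f : Fin k → Algorithm n m) {q} →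
                   (∀ c → queries (f c) M ≤ q) → queries (toss k f) M ≤ q
    queries-toss k f f≤q = foldr-⊔-lub (λ c → queries (f c) M) f≤q
      where
      foldr-⊔-lub : ∀ {k q} (g : Fin k → ℕ) → (∀ c → g c ≤ q) → foldr ℕ._⊔_ 0 g ≤ q
      foldr-⊔-lub {zero}  g g≤q = z≤n
      foldr-⊔-lub {suc k} g g≤q = ℕ.⊔-lub (g≤q zero) (foldr-⊔-lub (g ∘ suc) (g≤q ∘ suc))

    opaque
      unfolding avg

      Pr-toss : ∀ k .{{_ : NonZero k}} (f : Fin k → Algorithm n m) b →
                Pr[ toss k f on M outputs b ] ≡ avg k (λ c → Pr[ f c on M outputs b ])
      Pr-toss k f b = refl

    Pr-total : ∀ T → Pr[ T accepts M ] ℚ.+ Pr[ T rejects M ] ≡ 1ℚ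
    Pr-total (output true)  = refl
    Pr-total (output false) = refl
    Pr-total (query i j f)  = Pr-total (f (M i j))
    Pr-total (toss k f)     = trans (cong₂ ℚ._+_ (Pr-toss k f true) (Pr-toss k f false)) (trans (sym (avg-+ (λ c → Pr[ f c accepts M ]) (λ c → Pr[ f c rejects M ])))
      (trans (avg-cong (λ c → Pr-total (f c))) (avg-const 1ℚ)))

    Pr≥0 : ∀ T b → 0ℚ ℚ.≤ Pr[ T on M outputs b ]
    Pr≥0 (output b′)   b = 𝟙≥0 (does (b′ Bool.≟ b))
    Pr≥0 (query i j f) b = Pr≥0 (f (M i j)) b
    Pr≥0 (toss k f)    b = ≤-≡-trans (avg-nonNeg (λ c → Pr≥0 (f c) b)) (sym (Pr-toss k f b))

module Tester {n m : ℕ} .{{_ : NonZero n}} .{{_ : NonZero m}}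
              (verdict : ∀ {r} → List (Observation r) → Bool) (samples : ℕ) where

  drawPoint : ∀ {r} → State n m r → (Fin n → Fin m → Observation r → Algorithm n m) → Algorithm n m
  drawPoint st k = toss n λ i → toss m λ j → queryPoint st i j (k i j)

  test : ∀ {r} → ℕ → State n m r → List (Observation r) → Algorithm n m
  test zero    st obs = output (verdict obs)
  test (suc s) st obs = drawPoint st λ _ _ o → test s st (o ∷ obs)

  mutual
    -- The first number counts the rounds left, the second the pivots still allowed.
    eliminate : ∀ {r} → ℕ → ℕ → State n m r → Algorithm n m
    eliminate zero    f st = test samples st []
    eliminate (suc p) f st = drawPoint st (advance p f st)

    advance : ∀ {r} → ℕ → ℕ → State n m r → Fin n → Fin m → Observation r → Algorithm n m
    advance p f st i j (x , y , b) = step p f st i j x y (b xor x ⊙ y)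

    -- The residual bit is an argument of its own, so that proofs can replace it by a known value.
    step : ∀ {r} → ℕ → ℕ → State n m r → Fin n → Fin m → Vec Bool r → Vec Bool r → Bool → Algorithm n m
    step p f       st i j x y false = eliminate p f st
    -- A nonzero residual after `d` pivots shows that the rank over 𝔽₂, hence the binary rank,
    -- exceeds `d`.
    step p zero    st i j x y true  = output false
    step p (suc f) st i j x y true  = eliminate p f (pivot i j x y st)

  -- A fixed stopping time could fall on a round with large residual. At a uniform one, the expected
  -- residual error is the total over all `P` rounds divided by `P`.
  tester : (P : ℕ) .{{_ : NonZero P}} → ℕ → Algorithm n m
  tester P d = toss P λ p → eliminate (toℕ p) d initial

  module _ (M : Matrix n m) where

    Pr-drawPoint : ∀ {r} (st : State n m r) (k : Fin n → Fin m → Observation r → Algorithm n m) b →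
      Pr[ drawPoint st k on M outputs b ]
        ≡ avg₂ (λ i j → Pr[ k i j (observe M st i j) on M outputs b ])
    Pr-drawPoint st k b = trans (Pr-toss M n (λ i → toss m λ j → queryPoint st i j (k i j)) b) (avg-cong λ i →
      trans (Pr-toss M m (λ j → queryPoint st i j (k i j)) b) (avg-cong λ j → Pr-queryPoint M b st i j (k i j)))

    module _ (d : ℕ) where

      -- At most `d` queries for each of the two types, and one for the entry.
      pointCost : ℕ
      pointCost = d + suc d

      queries-drawPoint : ∀ {r} (st : State n m r) (k : Fin n → Fin m → Observation r → Algorithm n m) {q} →
        r ≤ d → (∀ i j → queries (k i j (observe M st i j)) M ≤ q) →
        queries (drawPoint st k) M ≤ pointCost + q
      queries-drawPoint {r} st k {q} r≤d k≤q =
        queries-toss M n (λ i → toss m λ j → queryPoint st i j (k i j)) λ i →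
        queries-toss M m (λ j → queryPoint st i j (k i j)) λ j → begin
          queries (queryPoint st i j (k i j)) M                   ≡⟨ queries-queryPoint M st i j (k i j) ⟩
          r + (r + suc (queries (k i j (observe M st i j)) M))    ≤⟨ ℕ.+-mono-≤ r≤d (ℕ.+-mono-≤ r≤d (s≤s (k≤q i j))) ⟩
          d + (d + suc q)                                         ≡⟨ cong (λ q → d + q) (ℕ.+-suc d q) ⟩
          d + (suc d + q)                                         ≡⟨ ℕ.+-assoc d (suc d) q ⟨
          pointCost + q                                           ∎
        where open ℕ.≤-Reasoning

      queries-test : ∀ {r} s (st : State n m r) obs → r ≤ d → queries (test s st obs) M ≤ s * pointCost
      queries-test zero    st obs r≤d = z≤n
      queries-test (suc s) st obs r≤d = queries-drawPoint st (λ _ _ o → test s st (o ∷ obs)) r≤d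
        λ i j → queries-test s st (observe M st i j ∷ obs) r≤d

      -- Each pivot moves one unit from `f` to `r`, so `r + f ≤ d` persists and no type ever has
      -- more than `d` bits.
      queries-eliminate : ∀ {r} p f (st : State n m r) → r + f ≤ d →
                          queries (eliminate p f st) M ≤ (p + samples) * pointCost
      queries-step : ∀ {r} p f (st : State n m r) i j x y b → r + f ≤ d →
                     queries (step p f st i j x y b) M ≤ (p + samples) * pointCost
      queries-eliminate {r} zero    f st r+f≤d = queries-test samples st [] (ℕ.m+n≤o⇒m≤o r r+f≤d)
      queries-eliminate {r} (suc p) f st r+f≤d = queries-drawPoint st (advance p f st) (ℕ.m+n≤o⇒m≤o r r+f≤d)
        λ i j → queries-step p f st i j (rowType M st i) (colType M st j) (residual M st i j) r+f≤d
      queries-step p f       st i j x y false r+f≤d = queries-eliminate p f st r+f≤d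
      queries-step p zero    st i j x y true  r+f≤d = z≤n
      queries-step {r} p (suc f) st i j x y true r+f≤d =
        queries-eliminate p f (pivot i j x y st) (subst (_≤ d) (ℕ.+-suc r f) r+f≤d)

      queries-tester : ∀ P .{{_ : NonZero P}} → queries (tester P d) M ≤ (P + samples) * pointCost
      queries-tester P = queries-toss M P (λ p → eliminate (toℕ p) d initial) λ p → ℕ.≤-trans (queries-eliminate (toℕ p) d initial ℕ.≤-refl)
        (ℕ.*-monoˡ-≤ pointCost (ℕ.+-monoˡ-≤ samples (ℕ.<⇒≤ (Fin.toℕ<n p))))

      module _ {c : ℚ} (0≤c : 0ℚ ℚ.≤ c)
               (test≤c : ∀ {r} (st : State n m r) → r ≤ d → Pr[ test samples st [] accepts M ] ℚ.≤ c) where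

        -- Soundness asks nothing of the elimination: whichever pivots it finds, the run either
        -- rejects or ends in a test that accepts with probability at most `c`.
        eliminate-accepts≤ : ∀ {r} p f (st : State n m r) → r + f ≤ d → Pr[ eliminate p f st accepts M ] ℚ.≤ c
        step-accepts≤ : ∀ {r} p f (st : State n m r) i j x y b → r + f ≤ d →
                        Pr[ step p f st i j x y b accepts M ] ℚ.≤ c
        eliminate-accepts≤ {r} zero    f st r+f≤d = test≤c st (ℕ.m+n≤o⇒m≤o r r+f≤d)
        eliminate-accepts≤ {r} (suc p) f st r+f≤d = ≡-≤-trans (Pr-drawPoint st (advance p f st) true)
          (avg-≤ λ i → avg-≤ λ j → step-accepts≤ p f st i j (rowType M st i) (colType M st j) (residual M st i j) r+f≤d)
        step-accepts≤ p f       st i j x y false r+f≤d = eliminate-accepts≤ p f st r+f≤d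
        step-accepts≤ p zero    st i j x y true  r+f≤d = 0≤c
        step-accepts≤ {r} p (suc f) st i j x y true r+f≤d =
          eliminate-accepts≤ p f (pivot i j x y st) (subst (_≤ d) (ℕ.+-suc r f) r+f≤d)

        tester-accepts≤ : ∀ P .{{_ : NonZero P}} → Pr[ tester P d accepts M ] ℚ.≤ c
        tester-accepts≤ P = ≡-≤-trans (Pr-toss M P (λ p → eliminate (toℕ p) d initial) true) (avg-≤ λ p → eliminate-accepts≤ (toℕ p) d initial ℕ.≤-refl)

-- Linear algebra over 𝔽₂ and ℤ

⊙-∷ : ∀ {k} (a b : Vec Bool (suc k)) →
      a ⊙ b ≡ (Vec.head a ∧ Vec.head b) xor Vec.tail a ⊙ Vec.tail b
⊙-∷ (a ∷ as) (b ∷ bs) = refl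

⊙-comm : ∀ {k} (a b : Vec Bool k) → a ⊙ b ≡ b ⊙ a
⊙-comm []       []       = refl
⊙-comm (a ∷ as) (b ∷ bs) = cong₂ _xor_ (Bool.∧-comm a b) (⊙-comm as bs)

infixl 6 _⊞[_]_
_⊞[_]_ : ∀ {k} → Vec Bool k → Bool → Vec Bool k → Vec Bool k
a ⊞[ c ] b = Vec.zipWith (λ x y → x xor (c ∧ y)) a b

⊞-⊙ : ∀ {k} c (a b e : Vec Bool k) → (a ⊞[ c ] b) ⊙ e ≡ (a ⊙ e) xor (c ∧ b ⊙ e)
⊞-⊙ c []       []       []       = sym (Bool.∧-zeroʳ c)
⊞-⊙ c (a ∷ as) (b ∷ bs) (e ∷ es) rewrite ⊞-⊙ c as bs es =
  ⊕-solve 6 (λ a b c e x y → (a ⊕ (c ⊗ b)) ⊗ e ⊕ (x ⊕ c ⊗ y) ⊜ (a ⊗ e ⊕ x) ⊕ c ⊗ (b ⊗ e ⊕ y)) refl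
    a b c e (as ⊙ es) (bs ⊙ es)
  where open BoolSolver.xor-∧-Solver renaming (solve to ⊕-solve; _:+_ to _⊕_; _:*_ to _⊗_; _:=_ to _⊜_)

⊙-⊞ : ∀ {k} c (e a b : Vec Bool k) → e ⊙ (a ⊞[ c ] b) ≡ (e ⊙ a) xor (c ∧ e ⊙ b)
⊙-⊞ c e a b rewrite ⊙-comm e (a ⊞[ c ] b) | ⊙-comm e a | ⊙-comm e b = ⊞-⊙ c a b e

module _ {I J : Set} where

  𝔽₂Rank≤ : (I → J → Bool) → ℕ → Set
  𝔽₂Rank≤ E k = Σ[ A ∈ (I → Vec Bool k) ] Σ[ G ∈ (J → Vec Bool k) ] (∀ i j → E i j ≡ A i ⊙ G j)

  schur : (I → J → Bool) → I → J → I → J → Bool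
  schur E i₀ j₀ i j = E i j xor (E i j₀ ∧ E i₀ j)

  𝔽₂Rank≤0 : ∀ {E} → 𝔽₂Rank≤ E 0 → ∀ i j → E i j ≡ false
  𝔽₂Rank≤0 (A , G , E≡AG) i j with A i | G j | E≡AG i j
  ... | [] | [] | eq = eq

  -- Clearing a row and a column with a nonzero pivot lowers the rank by one. The induction looks
  -- for a coordinate in which the factor row of `i₀` is 1 and removes that coordinate from both
  -- factors.
  𝔽₂Rank≤-schur : ∀ k {E} i₀ j₀ → E i₀ j₀ ≡ true → 𝔽₂Rank≤ E (suc k) → 𝔽₂Rank≤ (schur E i₀ j₀) k
  𝔽₂Rank≤-schur k {E} i₀ j₀ E₀≡true (A , G , E≡AG) with Vec.head (A i₀) in c₀
  -- Adding `c i` times row `i₀` clears the first coordinate of row `i`; on the other side, `E i₀ j`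
  -- times column `j₀` is added to column `j`.
  ... | true = (λ i → u i ⊞[ c i ] u i₀) , (λ j → h j ⊞[ E i₀ j ] h j₀) , λ i j → sym (begin
    (u i ⊞[ c i ] u i₀) ⊙ (h j ⊞[ E i₀ j ] h j₀)
      ≡⟨ ⊙-⊞ (E i₀ j) (u i ⊞[ c i ] u i₀) (h j) (h j₀) ⟩
    (u i ⊞[ c i ] u i₀) ⊙ h j xor (E i₀ j ∧ (u i ⊞[ c i ] u i₀) ⊙ h j₀)
      ≡⟨ cong₂ (λ x y → x xor (E i₀ j ∧ y)) (⊞-⊙ (c i) (u i) (u i₀) (h j)) (⊞-⊙ (c i) (u i) (u i₀) (h j₀)) ⟩
    (u i ⊙ h j xor (c i ∧ u i₀ ⊙ h j)) xor (E i₀ j ∧ (u i ⊙ h j₀ xor (c i ∧ u i₀ ⊙ h j₀)))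
      ≡⟨ cong (λ x → (u i ⊙ h j xor (c i ∧ u i₀ ⊙ h j)) xor (x ∧ (u i ⊙ h j₀ xor (c i ∧ u i₀ ⊙ h j₀)))) (E₀ j) ⟩
    (u i ⊙ h j xor (c i ∧ u i₀ ⊙ h j)) xor ((g j xor u i₀ ⊙ h j) ∧ (u i ⊙ h j₀ xor (c i ∧ u i₀ ⊙ h j₀)))
      ≡⟨ ⊕-solve 6 (λ c g uh vh uk vk →
           (uh ⊕ c ⊗ vh) ⊕ (g ⊕ vh) ⊗ (uk ⊕ c ⊗ vk)
             ⊜ (c ⊗ g ⊕ uh) ⊕ (c ⊗ (κ true ⊕ vk) ⊕ uk) ⊗ (g ⊕ vh))
           refl (c i) (g j) (u i ⊙ h j) (u i₀ ⊙ h j) (u i ⊙ h j₀) (u i₀ ⊙ h j₀) ⟩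
    ((c i ∧ g j) xor u i ⊙ h j) xor (((c i ∧ (true xor u i₀ ⊙ h j₀)) xor u i ⊙ h j₀) ∧ (g j xor u i₀ ⊙ h j))
      ≡⟨ cong₂ (λ x y → x xor (y ∧ (g j xor u i₀ ⊙ h j))) (sym (E≡ i j))
           (trans (cong (λ x → (c i ∧ x) xor u i ⊙ h j₀) g₀) (sym (E≡ i j₀))) ⟩
    E i j xor (E i j₀ ∧ (g j xor u i₀ ⊙ h j))
      ≡⟨ cong (λ x → E i j xor (E i j₀ ∧ x)) (sym (E₀ j)) ⟩
    schur E i₀ j₀ i j ∎)
    where
    open ≡-Reasoning
    open BoolSolver.xor-∧-Solver renaming (solve to ⊕-solve; _:+_ to _⊕_; _:*_ to _⊗_; _:=_ to _⊜_; con to κ)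
    c = Vec.head ∘ A
    u = Vec.tail ∘ A
    g = Vec.head ∘ G
    h = Vec.tail ∘ G
    E≡ : ∀ i j → E i j ≡ (c i ∧ g j) xor u i ⊙ h j
    E≡ i j = trans (E≡AG i j) (⊙-∷ (A i) (G j))
    E₀ : ∀ j → E i₀ j ≡ g j xor u i₀ ⊙ h j
    E₀ j = trans (E≡ i₀ j) (cong (λ x → (x ∧ g j) xor u i₀ ⊙ h j) c₀)
    g₀ : true xor u i₀ ⊙ h j₀ ≡ g j₀
    g₀ with g j₀ | u i₀ ⊙ h j₀ | trans (sym E₀≡true) (E₀ j₀)
    ... | true  | false | _ = refl
    ... | false | true  | _ = refl
  -- The only coordinate of row `i₀` is 0, so its entries vanish, against `E₀≡true`.
  𝔽₂Rank≤-schur zero {E} i₀ j₀ E₀≡true (A , G , E≡AG) | false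
    with A i₀ | G j₀ | c₀ | trans (sym E₀≡true) (E≡AG i₀ j₀)
  ... | false ∷ [] | _ ∷ [] | refl | ()
  -- Row `i₀` ignores the first coordinate, so it is also a row of the product `E₁` of the tails.
  -- The induction treats `E₁`, and the first coordinate is put back with a corrected column
  -- coefficient.
  𝔽₂Rank≤-schur (suc k) {E} i₀ j₀ E₀≡true (A , G , E≡AG) | false =
    (λ i → c i ∷ A₁ i) , (λ j → (g j xor (g j₀ ∧ E₁ i₀ j)) ∷ G₁ j) , λ i j → begin
      E i j xor (E i j₀ ∧ E i₀ j)
        ≡⟨ cong₂ _xor_ (E≡ i j) (cong₂ _∧_ (E≡ i j₀) (E₀ j)) ⟩
      ((c i ∧ g j) xor E₁ i j) xor (((c i ∧ g j₀) xor E₁ i j₀) ∧ E₁ i₀ j)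
        ≡⟨ ⊕-solve 6 (λ c g g₀ x y z → (c ⊗ g ⊕ x) ⊕ (c ⊗ g₀ ⊕ y) ⊗ z ⊜ c ⊗ (g ⊕ g₀ ⊗ z) ⊕ (x ⊕ y ⊗ z))
             refl (c i) (g j) (g j₀) (E₁ i j) (E₁ i j₀) (E₁ i₀ j) ⟩
      (c i ∧ (g j xor (g j₀ ∧ E₁ i₀ j))) xor schur E₁ i₀ j₀ i j
        ≡⟨ cong ((c i ∧ (g j xor (g j₀ ∧ E₁ i₀ j))) xor_) (proj₂ (proj₂ IH) i j) ⟩
      (c i ∧ (g j xor (g j₀ ∧ E₁ i₀ j))) xor A₁ i ⊙ G₁ j ∎
    where
    open ≡-Reasoning
    open BoolSolver.xor-∧-Solver renaming (solve to ⊕-solve; _:+_ to _⊕_; _:*_ to _⊗_; _:=_ to _⊜_)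
    c = Vec.head ∘ A
    g = Vec.head ∘ G
    E₁ : I → J → Bool
    E₁ i j = Vec.tail (A i) ⊙ Vec.tail (G j)
    E≡ : ∀ i j → E i j ≡ (c i ∧ g j) xor E₁ i j
    E≡ i j = trans (E≡AG i j) (⊙-∷ (A i) (G j))
    E₀ : ∀ j → E i₀ j ≡ E₁ i₀ j
    E₀ j = trans (E≡ i₀ j) (cong (λ x → (x ∧ g j) xor E₁ i₀ j) c₀)
    IH = 𝔽₂Rank≤-schur k {E₁} i₀ j₀ (trans (sym (E₀ j₀)) E₀≡true) (Vec.tail ∘ A , Vec.tail ∘ G , λ _ _ → refl)
    A₁ = proj₁ IH
    G₁ = proj₁ (proj₂ IH)

infix 7 _·_
_·_ : ∀ {k} → Vec ℤ k → Vec ℤ k → ℤ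
[]       · []       = + 0
(a ∷ as) · (b ∷ bs) = a ℤ.* b ℤ.+ as · bs

·-linearʳ : ∀ {k} c e (v a b : Vec ℤ k) →
            v · Vec.zipWith (λ x y → c ℤ.* x ℤ.- e ℤ.* y) a b ≡ c ℤ.* (v · a) ℤ.- e ℤ.* (v · b)
·-linearʳ c e []       []       []       = ℤ-solve 2 (λ c e → κ (+ 0) ⊜ c ⊗ κ (+ 0) ⊝ e ⊗ κ (+ 0)) refl c e
  where open ℤSolver.+-*-Solver renaming (solve to ℤ-solve; _:*_ to _⊗_; _:-_ to _⊝_; _:=_ to _⊜_; con to κ)
·-linearʳ c e (v ∷ vs) (a ∷ as) (b ∷ bs) rewrite ·-linearʳ c e vs as bs =
  ℤ-solve 7 (λ c e v a b x y → v ⊗ (c ⊗ a ⊝ e ⊗ b) ⊕ (c ⊗ x ⊝ e ⊗ y) ⊜ c ⊗ (v ⊗ a ⊕ x) ⊝ e ⊗ (v ⊗ b ⊕ y))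
    refl c e v a b (vs · as) (vs · bs)
  where open ℤSolver.+-*-Solver renaming (solve to ℤ-solve; _:+_ to _⊕_; _:*_ to _⊗_; _:-_ to _⊝_; _:=_ to _⊜_)

·-∷ : ∀ {k} (v w : Vec ℤ (suc k)) → v · w ≡ Vec.head v ℤ.* Vec.head w ℤ.+ Vec.tail v · Vec.tail w
·-∷ (v ∷ vs) (w ∷ ws) = refl

-- A vector with nonzero first coordinate is used to clear this coordinate in all others.
spanning : ∀ k {J : Set} (js : List J) {j₁} → j₁ ∈ js → (w : J → Vec ℤ k) →
  Σ[ t ∈ Vec J k ] (∀ l → lookup t l ∈ js) ×
    (∀ v → (∀ l → v · w (lookup t l) ≡ + 0) → ∀ {j} → j ∈ js → v · w j ≡ + 0)
spanning zero js _ w = [] , (λ ()) , λ v _ {j} _ → nil v (w j)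
  where
  nil : ∀ (v w : Vec ℤ 0) → v · w ≡ + 0
  nil [] [] = refl
spanning (suc k) {J} js {j₁} j₁∈js w with any? (λ j → ¬? (Vec.head (w j) ℤ.≟ + 0)) js
-- All first coordinates vanish on `js`, and `j₁` merely pads the vector to its length.
... | no heads≡0 = j₁ ∷ t , (λ { zero → j₁∈js ; (suc l) → t⊆js l }) ,
      λ v v⊥t j∈js → trans (drop v j∈js) (t-spans (Vec.tail v) (λ l → trans (sym (drop v (t⊆js l))) (v⊥t (suc l))) j∈js)
  where
  IH = spanning k js j₁∈js (Vec.tail ∘ w)
  t = proj₁ IH
  t⊆js = proj₁ (proj₂ IH)
  t-spans = proj₂ (proj₂ IH)
  head≡0 : ∀ {j} → j ∈ js → Vec.head (w j) ≡ + 0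
  head≡0 {j} j∈js with Vec.head (w j) ℤ.≟ + 0
  ... | yes eq = eq
  ... | no neq = contradiction (lose j∈js neq) heads≡0
  drop : ∀ v {j} → j ∈ js → v · w j ≡ Vec.tail v · Vec.tail (w j)
  drop v {j} j∈js = trans (·-∷ v (w j)) (trans (cong (λ x → Vec.head v ℤ.* x ℤ.+ Vec.tail v · Vec.tail (w j)) (head≡0 j∈js))
    (trans (cong (ℤ._+ Vec.tail v · Vec.tail (w j)) (ℤ.*-zeroʳ (Vec.head v))) (ℤ.+-identityˡ _)))
... | yes head≢0 = j₀ ∷ t , (λ { zero → j₀∈js ; (suc l) → t⊆js l }) , spans
  where
  j₀ = proj₁ (find head≢0)
  j₀∈js = proj₁ (proj₂ (find head≢0))
  c = Vec.head (w j₀)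
  -- Cross multiplication clears the coordinate without division; the factor `c` is cancelled at the
  -- end, since ℤ has no zero divisors.
  w′ : J → Vec ℤ k
  w′ j = Vec.zipWith (λ x y → c ℤ.* x ℤ.- Vec.head (w j) ℤ.* y) (Vec.tail (w j)) (Vec.tail (w j₀))
  IH = spanning k js j₁∈js w′
  t = proj₁ IH
  t⊆js = proj₁ (proj₂ IH)
  t-spans = proj₂ (proj₂ IH)
  eliminated : ∀ v j → v · w j₀ ≡ + 0 → Vec.tail v · w′ j ≡ c ℤ.* (v · w j)
  eliminated v j v⊥j₀ = begin
    Vec.tail v · w′ j
      ≡⟨ ·-linearʳ c (Vec.head (w j)) (Vec.tail v) (Vec.tail (w j)) (Vec.tail (w j₀)) ⟩
    c ℤ.* y ℤ.- Vec.head (w j) ℤ.* y₀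
      ≡⟨ ℤ-solve 5 (λ c x v y z → c ⊗ y ⊝ x ⊗ z ⊜ c ⊗ (v ⊗ x ⊕ y) ⊝ x ⊗ (v ⊗ c ⊕ z)) refl c (Vec.head (w j)) (Vec.head v) y y₀ ⟩
    c ℤ.* (Vec.head v ℤ.* Vec.head (w j) ℤ.+ y) ℤ.- Vec.head (w j) ℤ.* (Vec.head v ℤ.* c ℤ.+ y₀)
      ≡⟨ cong₂ (λ a b → c ℤ.* a ℤ.- Vec.head (w j) ℤ.* b) (sym (·-∷ v (w j))) (trans (sym (·-∷ v (w j₀))) v⊥j₀) ⟩
    c ℤ.* (v · w j) ℤ.- Vec.head (w j) ℤ.* + 0
      ≡⟨ ℤ-solve 2 (λ a x → a ⊝ x ⊗ κ (+ 0) ⊜ a) refl (c ℤ.* (v · w j)) (Vec.head (w j)) ⟩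
    c ℤ.* (v · w j) ∎
    where
    open ≡-Reasoning
    open ℤSolver.+-*-Solver renaming (solve to ℤ-solve; _:+_ to _⊕_; _:*_ to _⊗_; _:-_ to _⊝_; _:=_ to _⊜_; con to κ)
    y = Vec.tail v · Vec.tail (w j)
    y₀ = Vec.tail v · Vec.tail (w j₀)
  spans : ∀ v → (∀ l → v · w (lookup (j₀ ∷ t) l) ≡ + 0) → ∀ {j} → j ∈ js → v · w j ≡ + 0
  spans v v⊥t {j} j∈js = cancel (proj₂ (proj₂ (find head≢0)))
    (trans (sym (eliminated v j (v⊥t zero))) (t-spans (Vec.tail v) tail⊥t j∈js))
    where
    tail⊥t : ∀ l → Vec.tail v · w′ (lookup t l) ≡ + 0
    tail⊥t l = trans (eliminated v (lookup t l) (v⊥t zero)) (trans (cong (c ℤ.*_) (v⊥t (suc l))) (ℤ.*-zeroʳ c))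
    cancel : ∀ {x y} → x ≢ + 0 → x ℤ.* y ≡ + 0 → y ≡ + 0
    cancel {x} x≢0 xy≡0 with ℤ.i*j≡0⇒i≡0∨j≡0 x xy≡0
    ... | inj₁ x≡0 = contradiction x≡0 x≢0
    ... | inj₂ y≡0 = y≡0

-- Integer inner products of Boolean vectors

bit : Bool → ℕ
bit b = if b then 1 else 0

infix 7 _∙_
_∙_ : ∀ {k} → Vec Bool k → Vec Bool k → ℕ
[]       ∙ []       = 0
(a ∷ as) ∙ (b ∷ bs) = bit (a ∧ b) + as ∙ bs

∙-comm : ∀ {k} (a b : Vec Bool k) → a ∙ b ≡ b ∙ a
∙-comm []       []       = refl
∙-comm (a ∷ as) (b ∷ bs) = cong₂ _+_ (cong bit (Bool.∧-comm a b)) (∙-comm as bs)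

∙-zeroʳ : ∀ {k} (a : Vec Bool k) → a ∙ Vec.replicate k false ≡ 0
∙-zeroʳ []       = refl
∙-zeroʳ (a ∷ as) = trans (cong (λ b → bit b + as ∙ Vec.replicate _ false) (Bool.∧-zeroʳ a)) (∙-zeroʳ as)

⊙-zeroʳ : ∀ {k} (a : Vec Bool k) → a ⊙ Vec.replicate k false ≡ false
⊙-zeroʳ []       = refl
⊙-zeroʳ (a ∷ as) = trans (cong (λ b → b xor as ⊙ Vec.replicate _ false) (Bool.∧-zeroʳ a)) (⊙-zeroʳ as)

bit≤1 : ∀ b → bit b ≤ 1
bit≤1 true  = s≤s z≤n
bit≤1 false = z≤n

-- Reduction modulo 2. It turns a binary factorization into one over 𝔽₂ with the same inner
-- dimension.
∙⇒⊙ : ∀ {k} (a b : Vec Bool k) {c} → a ∙ b ≡ bit c → a ⊙ b ≡ c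
∙⇒⊙ []       []       {false} eq = refl
∙⇒⊙ (a ∷ as) (b ∷ bs) {c}     eq with a ∧ b
... | false = ∙⇒⊙ as bs eq
∙⇒⊙ (a ∷ as) (b ∷ bs) {true}  eq | true = cong not (∙⇒⊙ as bs {false} (ℕ.suc-injective eq))

⌜_⌝ : ∀ {k} → Vec Bool k → Vec ℤ k
⌜_⌝ = Vec.map (λ b → + bit b)

⌜⌝-· : ∀ {k} (a b : Vec Bool k) → ⌜ a ⌝ · ⌜ b ⌝ ≡ + (a ∙ b)
⌜⌝-· []       []       = refl
⌜⌝-· (a ∷ as) (b ∷ bs) = trans (cong₂ ℤ._+_ (bit-* a b) (⌜⌝-· as bs)) refl
  where
  bit-* : ∀ a b → + bit a ℤ.* + bit b ≡ + bit (a ∧ b)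
  bit-* true  true  = refl
  bit-* true  false = refl
  bit-* false b     = refl

·-subˡ : ∀ {k} (a b w : Vec ℤ k) → Vec.zipWith ℤ._-_ a b · w ≡ a · w ℤ.- b · w
·-subˡ []       []       []       = refl
·-subˡ (a ∷ as) (b ∷ bs) (w ∷ ws) rewrite ·-subˡ as bs ws =
  ℤ-solve 5 (λ a b w x y → (a ⊝ b) ⊗ w ⊕ (x ⊝ y) ⊜ (a ⊗ w ⊕ x) ⊝ (b ⊗ w ⊕ y)) refl a b w (as · ws) (bs · ws)
  where open ℤSolver.+-*-Solver renaming (solve to ℤ-solve; _:+_ to _⊕_; _:*_ to _⊗_; _:-_ to _⊝_; _:=_ to _⊜_)

-- Apply `spanning` to the difference of `a` and `b`. This is an integer vector with entries in -1,
-- 0, 1, which is why the elimination there is over ℤ.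
determining : ∀ {k} {J : Set} (js : List J) {j₁} → j₁ ∈ js → (w : J → Vec Bool k) →
  Σ[ t ∈ Vec J k ] (∀ l → lookup t l ∈ js) ×
    (∀ a b → (∀ l → a ∙ w (lookup t l) ≡ b ∙ w (lookup t l)) → ∀ {j} → j ∈ js → a ∙ w j ≡ b ∙ w j)
determining {k} js j₁∈js w = t , t⊆js , λ a b a≡b {j} j∈js → ℤ.+-injective (ℤ.i-j≡0⇒i≡j _ _
    (trans (sym (expand a b j)) (t-spans (Vec.zipWith ℤ._-_ ⌜ a ⌝ ⌜ b ⌝) (λ l → trans (expand a b _) (ℤ.i≡j⇒i-j≡0 (cong +_ (a≡b l)))) j∈js)))
  where
  S = spanning k js j₁∈js (⌜_⌝ ∘ w)
  t = proj₁ S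
  t⊆js = proj₁ (proj₂ S)
  t-spans = proj₂ (proj₂ S)
  expand : ∀ a b j → Vec.zipWith ℤ._-_ ⌜ a ⌝ ⌜ b ⌝ · ⌜ w j ⌝ ≡ + (a ∙ w j) ℤ.- + (b ∙ w j)
  expand a b j = trans (·-subˡ ⌜ a ⌝ ⌜ b ⌝ ⌜ w j ⌝) (cong₂ ℤ._-_ (⌜⌝-· a (w j)) (⌜⌝-· b (w j)))

Common : ∀ {k} → Vec Bool k → Vec Bool k → Fin k → Set
Common a b l = lookup a l ≡ true × lookup b l ≡ true

∙≡0 : ∀ {k} (a b : Vec Bool k) → (∀ l → ¬ Common a b l) → a ∙ b ≡ 0
∙≡0 []           []           disj = refl
∙≡0 (true ∷ as)  (true ∷ bs)  disj = contradiction (refl , refl) (disj zero)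
∙≡0 (true ∷ as)  (false ∷ bs) disj = ∙≡0 as bs (disj ∘ suc)
∙≡0 (false ∷ as) (b ∷ bs)     disj = ∙≡0 as bs (disj ∘ suc)

∙≤1 : ∀ {k} (a b : Vec Bool k) → (∀ l l′ → l ≢ l′ → Common a b l → ¬ Common a b l′) → a ∙ b ≤ 1
∙≤1 []           []           disj = z≤n
∙≤1 (true ∷ as)  (true ∷ bs)  disj = s≤s (ℕ.≤-reflexive (∙≡0 as bs λ l → disj zero (suc l) (λ ()) (refl , refl)))
∙≤1 (true ∷ as)  (false ∷ bs) disj = ∙≤1 as bs λ l l′ l≢l′ → disj (suc l) (suc l′) (l≢l′ ∘ Fin.suc-injective)
∙≤1 (false ∷ as) (b ∷ bs)     disj = ∙≤1 as bs λ l l′ l≢l′ → disj (suc l) (suc l′) (l≢l′ ∘ Fin.suc-injective)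

1≤∙ : ∀ {k} (a b : Vec Bool k) l → Common a b l → 1 ≤ a ∙ b
1≤∙ (true ∷ as) (true ∷ bs) zero    (refl , refl) = s≤s z≤n
1≤∙ (a ∷ as)    (b ∷ bs)    (suc l) common        = ℕ.≤-trans (1≤∙ as bs l common) (ℕ.m≤n+m _ (bit (a ∧ b)))

2≤∙ : ∀ {k} (a b : Vec Bool k) l l′ → l ≢ l′ → Common a b l → Common a b l′ → 2 ≤ a ∙ b
2≤∙ a           b           zero    zero     l≢l′ _ _ = contradiction refl l≢l′
2≤∙ (true ∷ as) (true ∷ bs) zero    (suc l′) _    (refl , refl) common = s≤s (1≤∙ as bs l′ common)
2≤∙ (true ∷ as) (true ∷ bs) (suc l) zero     _    common (refl , refl) = s≤s (1≤∙ as bs l common)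
2≤∙ (a ∷ as)    (b ∷ bs)    (suc l) (suc l′) l≢l′ common common′ =
  ℕ.≤-trans (2≤∙ as bs l l′ (l≢l′ ∘ cong suc) common common′) (ℕ.m≤n+m _ (bit (a ∧ b)))

-- Candidate factorizations

record Enumeration (A : Set) (e : ℕ) : Set where
  field
    elements : List A
    complete : ∀ a → a ∈ elements
    size     : length elements ≤ 2 ^ e

open Enumeration

length-cartesianProduct : ∀ {A B : Set} (xs : List A) (ys : List B) →
                          length (cartesianProduct xs ys) ≡ length xs * length ys
length-cartesianProduct []       ys = refl
length-cartesianProduct (x ∷ xs) ys = trans (List.length-++ (map (x ,_) ys))
  (cong₂ _+_ (List.length-map (x ,_) ys) (length-cartesianProduct xs ys))

Bool-enum : Enumeration Bool 1
Bool-enum .elements       = true ∷ false ∷ []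
Bool-enum .complete true  = here refl
Bool-enum .complete false = there (here refl)
Bool-enum .size           = ℕ.≤-refl

×-enum : ∀ {A B a b} → Enumeration A a → Enumeration B b → Enumeration (A × B) (a + b)
×-enum 𝒜 ℬ .elements         = cartesianProduct (elements 𝒜) (elements ℬ)
×-enum 𝒜 ℬ .complete (x , y) = ∈.∈-cartesianProduct⁺ (complete 𝒜 x) (complete ℬ y)
×-enum {a = a} {b = b} 𝒜 ℬ .size = begin
  length (cartesianProduct (elements 𝒜) (elements ℬ))  ≡⟨ length-cartesianProduct (elements 𝒜) (elements ℬ) ⟩
  length (elements 𝒜) * length (elements ℬ)            ≤⟨ ℕ.*-mono-≤ (size 𝒜) (size ℬ) ⟩
  2 ^ a * 2 ^ b                                        ≡⟨ ℕ.^-distribˡ-+-* 2 a b ⟨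
  2 ^ (a + b)                                          ∎
  where open ℕ.≤-Reasoning

Vec-enum : ∀ {A a} → Enumeration A a → ∀ n → Enumeration (Vec A n) (n * a)
Vec-enum 𝒜 zero .elements    = [] ∷ []
Vec-enum 𝒜 zero .complete [] = here refl
Vec-enum 𝒜 zero .size        = ℕ.≤-refl
Vec-enum 𝒜 (suc n) .elements = map (λ (x , xs) → x ∷ xs) (elements (×-enum 𝒜 (Vec-enum 𝒜 n)))
Vec-enum 𝒜 (suc n) .complete (x ∷ xs) =
  ∈.∈-map⁺ (λ (x , xs) → x ∷ xs) (complete (×-enum 𝒜 (Vec-enum 𝒜 n)) (x , xs))
Vec-enum 𝒜 (suc n) .size = ℕ.≤-trans
  (ℕ.≤-reflexive (List.length-map (λ (x , xs) → x ∷ xs) (elements (×-enum 𝒜 (Vec-enum 𝒜 n)))))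
  (size (×-enum 𝒜 (Vec-enum 𝒜 n)))

module _ {d : ℕ} where

  ∅ : Vec Bool d
  ∅ = Vec.replicate d false

  ∉∅ : ∀ l → lookup ∅ l ≢ true
  ∉∅ l l∈∅ with trans (sym (Vec.lookup-replicate l false)) l∈∅
  ... | ()

  -- Each pair in `ts` consists of the type and the vector of one sampled column. The types alone
  -- predict the entries in these columns, and `a` has to produce them as integer products.
  Agrees : ∀ {r} → Vec (Vec Bool r × Vec Bool d) d → Vec Bool r → Vec Bool d → Set
  Agrees ts x a = ∀ l → a ∙ proj₂ (lookup ts l) ≡ bit (x ⊙ proj₁ (lookup ts l))

  module _ {r : ℕ} {Q : Vec Bool d → Set} (Q? : Decidable Q)
           (ts : Vec (Vec Bool r × Vec Bool d) d) (x : Vec Bool r) where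

    candidate? : Decidable (λ a → Q a × Agrees ts x a)
    candidate? a = Q? a ×-dec Fin.all? λ l → a ∙ proj₂ (lookup ts l) ℕ.≟ bit (x ⊙ proj₁ (lookup ts l))

    opaque
      -- An exhaustive search that sees only `x` and `ts`, so that its result is a function of the
      -- type.
      decode : Vec Bool d
      decode with any? candidate? (elements (Vec-enum Bool-enum d))
      ... | yes p = proj₁ (satisfied p)
      -- The default is the empty set because it is both a clique and independent, so predictions
      -- stay 0 or 1 even when the search fails.
      ... | no _  = ∅

      decode-Q : Q ∅ → Q decode
      decode-Q Q∅ with any? candidate? (elements (Vec-enum Bool-enum d))
      ... | yes p = proj₁ (proj₂ (satisfied p))
      ... | no _  = Q∅

      decode-agrees : ∀ {a} → Q a → Agrees ts x a → Agrees ts x decode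
      decode-agrees {a} Qa agrees with any? candidate? (elements (Vec-enum Bool-enum d))
      ... | yes p = proj₂ (proj₂ (satisfied p))
      ... | no ¬p = contradiction (lose (complete (Vec-enum Bool-enum d) a) (Qa , agrees)) ¬p

  Graph : Set
  Graph = Vec (Vec Bool d) d

  Edge : Graph → Fin d → Fin d → Set
  Edge Γ l l′ = lookup (lookup Γ l) l′ ≡ true

  Clique Independent : Graph → Vec Bool d → Set
  Clique      Γ a = ∀ l l′ → l ≢ l′ → lookup a l ≡ true → lookup a l′ ≡ true → Edge Γ l l′
  Independent Γ b = ∀ l l′ → l ≢ l′ → lookup b l ≡ true → lookup b l′ ≡ true → ¬ Edge Γ l l′

  edge? : ∀ Γ l l′ → Dec (Edge Γ l l′)
  edge? Γ l l′ = lookup (lookup Γ l) l′ Bool.≟ true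

  clique? : ∀ Γ → Decidable (Clique Γ)
  clique? Γ a = Fin.all? λ l → Fin.all? λ l′ → ¬? (l Fin.≟ l′) →-dec
    (lookup a l Bool.≟ true) →-dec (lookup a l′ Bool.≟ true) →-dec edge? Γ l l′

  independent? : ∀ Γ → Decidable (Independent Γ)
  independent? Γ b = Fin.all? λ l → Fin.all? λ l′ → ¬? (l Fin.≟ l′) →-dec
    (lookup b l Bool.≟ true) →-dec (lookup b l′ Bool.≟ true) →-dec ¬? (edge? Γ l l′)

  -- Two common vertices would be both joined and not joined.
  clique-independent : ∀ Γ {a b} → Clique Γ a → Independent Γ b → a ∙ b ≤ 1
  clique-independent Γ {a} {b} clq ind = ∙≤1 a b λ l l′ l≢l′ (al , bl) (al′ , bl′) →
    ind l l′ l≢l′ bl bl′ (clq l l′ l≢l′ al al′)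

-- A factorization whose rows (columns) are functions of the row (column) types only.
-- The rows are cliques and the columns independent sets of one graph on the inner
-- indices, which makes every entry of the product 0 or 1.
Hypothesis : ℕ → ℕ → Set
Hypothesis d r = Vec (Vec Bool d) d × Vec (Vec Bool r × Vec Bool d) d × Vec (Vec Bool r × Vec Bool d) d

hypotheses : ∀ d r → Enumeration (Hypothesis d r) (d * (d * 1) + (d * (r * 1 + d * 1) + d * (r * 1 + d * 1)))
hypotheses d r = ×-enum (Vec-enum (Vec-enum Bool-enum d) d) (×-enum ts ts)
  where ts = Vec-enum (×-enum (Vec-enum Bool-enum r) (Vec-enum Bool-enum d)) d

module _ {d r : ℕ} (h : Hypothesis d r) where

  leftFactor rightFactor : Vec Bool r → Vec Bool d
  leftFactor  = decode (clique? (proj₁ h)) (proj₁ (proj₂ h))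
  rightFactor = decode (independent? (proj₁ h)) (proj₂ (proj₂ h))

  prediction≤1 : ∀ x y → leftFactor x ∙ rightFactor y ≤ 1
  prediction≤1 x y = clique-independent Γ {leftFactor x} {rightFactor y}
    (decode-Q (clique? Γ) (proj₁ (proj₂ h)) x λ l _ _ l∈∅ _ → contradiction l∈∅ (∉∅ {d} l))
    (decode-Q (independent? Γ) (proj₂ (proj₂ h)) y λ l _ _ l∈∅ _ → contradiction l∈∅ (∉∅ {d} l))
    where Γ = proj₁ h

  miss : Observation r → Bool
  miss (x , y , b) = not (does (leftFactor x ∙ rightFactor y ℕ.≟ bit b))

  misses : List (Observation r) → ℕ
  misses []        = 0
  misses (o ∷ obs) = bit (miss o) + misses obs

plausible? : ∀ {d r} κ (obs : List (Observation r)) → Decidable (λ (h : Hypothesis d r) → misses h obs ≤ κ)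
plausible? κ obs h = misses h obs ℕ.≤? κ

verdict : ∀ d κ {r} → List (Observation r) → Bool
verdict d κ {r} obs = does (any? (plausible? κ obs) (elements (hypotheses d r)))

-- Soundness

½ : ℚ
½ = ℚ.½

½^bit : ∀ b → ½ Exp.^ bit b ≡ 1ℚ ℚ.- ½ ℚ.* 𝟙 b
½^bit true  = refl
½^bit false = refl

½≥0 : 0ℚ ℚ.≤ ½
½≥0 = ℚ.nonNegative⁻¹ ½

½^-positive : ∀ k → ℚ.Positive (½ Exp.^ k)
½^-positive zero    = _
½^-positive (suc k) = ℚ.pos*pos⇒pos ½ (½ Exp.^ k) {{½^-positive k}}

½^-antitone : ∀ {k l} → k ≤ l → ½ Exp.^ l ℚ.≤ ½ Exp.^ k
½^-antitone {l = zero}  z≤n = ℚ.≤-refl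
½^-antitone {l = suc l} z≤n = ℚ.≤-trans (*-mono-≤ ½≥0 (½^-antitone {l = l} z≤n)) (ℚ.≤ᵇ⇒≤ _)
½^-antitone (s≤s k≤l) = *-mono-≤ ½≥0 (½^-antitone k≤l)

½^-*-2^ : ∀ k → ½ Exp.^ k ℚ.* ι (2 ^ k) ≡ 1ℚ
½^-*-2^ zero    = refl
½^-*-2^ (suc k) = trans (cong ((½ Exp.^ suc k) ℚ.*_) (ι-* 2 (2 ^ k)))
  (trans (solve 4 (λ h t p q → (h :* p) :* (t :* q) := (h :* t) :* (p :* q)) refl ½ (ι 2) (½ Exp.^ k) (ι (2 ^ k)))
  (trans (ℚ.*-identityˡ _) (½^-*-2^ k)))

^-mono : ∀ {p q} k → 0ℚ ℚ.≤ p → p ℚ.≤ q → p Exp.^ k ℚ.≤ q Exp.^ k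
^-mono zero    0≤p p≤q = ℚ.≤-refl
^-mono (suc k) 0≤p p≤q = *-mono₂-≤ 0≤p (^-nonNeg k (ℚ.≤-trans 0≤p p≤q)) p≤q (^-mono k 0≤p p≤q)

-- Bernoulli's inequality as an upper bound 1/(1 + nx) on the power, free of division. The induction
-- rests on (1 - x)(1 + (n + 1)x) = 1 + nx - (n + 1)x².
bernoulli : ∀ {x} → 0ℚ ℚ.≤ x → x ℚ.≤ 1ℚ → ∀ n → ((1ℚ ℚ.- x) Exp.^ n) ℚ.* (1ℚ ℚ.+ ι n ℚ.* x) ℚ.≤ 1ℚ
bernoulli {x} 0≤x x≤1 zero    = ℚ.≤-reflexive (solve 1 (λ x → con 1ℚ :* (con 1ℚ :+ con 0ℚ :* x) := con 1ℚ) refl x)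
bernoulli {x} 0≤x x≤1 (suc n) = begin
  (q ℚ.* (q Exp.^ n)) ℚ.* (1ℚ ℚ.+ (1ℚ ℚ.+ ι n) ℚ.* x)
    ≡⟨ solve 3 (λ x y k → ((con 1ℚ :- x) :* y) :* (con 1ℚ :+ (con 1ℚ :+ k) :* x)
                       := y :* (con 1ℚ :+ k :* x) :- y :* ((con 1ℚ :+ k) :* (x :* x))) refl x (q Exp.^ n) (ι n) ⟩
  (q Exp.^ n) ℚ.* (1ℚ ℚ.+ ι n ℚ.* x) ℚ.- (q Exp.^ n) ℚ.* (ι (suc n) ℚ.* (x ℚ.* x))
    ≤⟨ p-q≤p _ (*-nonNeg (^-nonNeg n 0≤q) (*-nonNeg (ι≥0 (suc n)) (*-nonNeg 0≤x 0≤x))) ⟩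
  (q Exp.^ n) ℚ.* (1ℚ ℚ.+ ι n ℚ.* x)
    ≤⟨ bernoulli 0≤x x≤1 n ⟩
  1ℚ ∎
  where
  open ℚ.≤-Reasoning
  q = 1ℚ ℚ.- x
  0≤q : 0ℚ ℚ.≤ q
  0≤q = ≡-≤-trans (sym (ℚ.+-inverseʳ x)) (ℚ.+-monoˡ-≤ (ℚ.- x) x≤1)
  p-q≤p : ∀ p {q} → 0ℚ ℚ.≤ q → p ℚ.- q ℚ.≤ p
  p-q≤p p 0≤q = ≤-≡-trans (ℚ.+-monoʳ-≤ p (ℚ.neg-antimono-≤ 0≤q)) (ℚ.+-identityʳ p)

module _ {n m : ℕ} .{{_ : NonZero n}} .{{_ : NonZero m}} (M : Matrix n m) where

  missProbability : ∀ {d r} → State n m r → Hypothesis d r → ℚ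
  missProbability st h = avg₂ λ i j → 𝟙 (miss h (observe M st i j))

module _ {n m : ℕ} .{{_ : NonZero n}} .{{_ : NonZero m}} (M : Matrix n m) (d κ samples : ℕ) where
  open Tester {n} {m} (verdict d κ) samples

  module _ {r : ℕ} (st : State n m r) where

    private
      hs = elements (hypotheses d r)

    -- The moment generating function of the number of misses, at −ln 2.
    potential : List (Observation r) → ℚ
    potential obs = ℚSum.sum λ k → ½ Exp.^ misses (List.lookup hs k) obs

    module _ {q : ℚ} (0≤q : 0ℚ ℚ.≤ q) (½^miss≤q : ∀ (h : Hypothesis d r) → avg₂ (λ i j → ½ Exp.^ bit (miss h (observe M st i j))) ℚ.≤ q) where

      -- A draw multiplies the summand of each hypothesis by ½ if it misses and by 1 otherwise, a
      -- factor whose average is at most `q`. The sum over the hypotheses carries the union bound.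
      avg-potential : ∀ obs → avg₂ (λ i j → potential (observe M st i j ∷ obs)) ℚ.≤ q ℚ.* potential obs
      avg-potential obs = begin
        avg₂ (λ i j → potential (observe M st i j ∷ obs))
          ≡⟨ avg₂-sum (λ i j k → ½ Exp.^ misses (List.lookup hs k) (observe M st i j ∷ obs)) ⟩
        ℚSum.sum (λ k → avg₂ (λ i j → ½ Exp.^ misses (List.lookup hs k) (observe M st i j ∷ obs)))
          ≤⟨ sum-mono (λ k → bound (List.lookup hs k)) ⟩
        ℚSum.sum (λ k → q ℚ.* ½ Exp.^ misses (List.lookup hs k) obs)
          ≡⟨ ℚSum.*-distribˡ-sum q (λ k → ½ Exp.^ misses (List.lookup hs k) obs) ⟨
        q ℚ.* potential obs ∎
        where
        open ℚ.≤-Reasoning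
        bound : ∀ h → avg₂ (λ i j → ½ Exp.^ misses h (observe M st i j ∷ obs)) ℚ.≤ q ℚ.* ½ Exp.^ misses h obs
        bound h = begin
          avg₂ (λ i j → ½ Exp.^ (bit (miss h (observe M st i j)) + misses h obs))
            ≡⟨ avg₂-cong (λ i j → trans (Exp.^-homo-* ½ (bit (miss h (observe M st i j))) (misses h obs)) (ℚ.*-comm (½ Exp.^ bit (miss h (observe M st i j))) (½ Exp.^ misses h obs))) ⟩
          avg₂ (λ i j → ½ Exp.^ misses h obs ℚ.* ½ Exp.^ bit (miss h (observe M st i j)))
            ≡⟨ avg₂-* (½ Exp.^ misses h obs) (λ i j → ½ Exp.^ bit (miss h (observe M st i j))) ⟩
          ½ Exp.^ misses h obs ℚ.* avg₂ (λ i j → ½ Exp.^ bit (miss h (observe M st i j)))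
            ≤⟨ *-mono-≤ (^-nonNeg (misses h obs) ½≥0) (½^miss≤q h) ⟩
          ½ Exp.^ misses h obs ℚ.* q
            ≡⟨ ℚ.*-comm (½ Exp.^ misses h obs) q ⟩
          q ℚ.* ½ Exp.^ misses h obs ∎

      -- Markov's inequality for the potential: acceptance means that some hypothesis has at most
      -- `κ` misses, and its summand alone is then at least `½ Exp.^ κ`.
      test-potential : ∀ s obs → ½ Exp.^ κ ℚ.* Pr[ test s st obs accepts M ] ℚ.≤ q Exp.^ s ℚ.* potential obs
      test-potential zero obs with any? (plausible? κ obs) hs
      ... | yes p = begin
        ½ Exp.^ κ ℚ.* 1ℚ                                          ≡⟨ ℚ.*-identityʳ (½ Exp.^ κ) ⟩
        ½ Exp.^ κ                                                 ≤⟨ ½^-antitone (Any.lookup-index p) ⟩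
        ½ Exp.^ misses (List.lookup hs (Any.index p)) obs         ≤⟨ term≤sum _ (λ k → ^-nonNeg (misses (List.lookup hs k) obs) ½≥0) (Any.index p) ⟩
        potential obs                                             ≡⟨ ℚ.*-identityˡ (potential obs) ⟨
        1ℚ ℚ.* potential obs                                      ∎
        where open ℚ.≤-Reasoning
      ... | no _ = ≡-≤-trans (ℚ.*-zeroʳ (½ Exp.^ κ))
        (*-nonNeg 0≤1 (sum-nonNeg _ λ k → ^-nonNeg (misses (List.lookup hs k) obs) ½≥0))
      test-potential (suc s) obs = begin
        ½ Exp.^ κ ℚ.* Pr[ test (suc s) st obs accepts M ]
          ≡⟨ cong (½ Exp.^ κ ℚ.*_) (Pr-drawPoint M st (λ _ _ o → test s st (o ∷ obs)) true) ⟩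
        ½ Exp.^ κ ℚ.* avg₂ (λ i j → Pr[ test s st (observe M st i j ∷ obs) accepts M ])
          ≡⟨ avg₂-* (½ Exp.^ κ) (λ i j → Pr[ test s st (observe M st i j ∷ obs) accepts M ]) ⟨
        avg₂ (λ i j → ½ Exp.^ κ ℚ.* Pr[ test s st (observe M st i j ∷ obs) accepts M ])
          ≤⟨ avg₂-mono (λ i j → test-potential s (observe M st i j ∷ obs)) ⟩
        avg₂ (λ i j → q Exp.^ s ℚ.* potential (observe M st i j ∷ obs))
          ≡⟨ avg₂-* (q Exp.^ s) (λ i j → potential (observe M st i j ∷ obs)) ⟩
        q Exp.^ s ℚ.* avg₂ (λ i j → potential (observe M st i j ∷ obs))
          ≤⟨ *-mono-≤ (^-nonNeg s 0≤q) (avg-potential obs) ⟩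
        q Exp.^ s ℚ.* (q ℚ.* potential obs)
          ≡⟨ solve 3 (λ a b c → a :* (b :* c) := (b :* a) :* c) refl (q Exp.^ s) q (potential obs) ⟩
        q Exp.^ suc s ℚ.* potential obs ∎
        where open ℚ.≤-Reasoning

    potential-[] : ∀ {L} → length hs ≤ 2 ^ L → potential [] ℚ.≤ ι (2 ^ L)
    potential-[] hs≤ = ≡-≤-trans (trans (sum-const (length hs) 1ℚ) (ℚ.*-identityʳ (ι (length hs)))) (ι-mono hs≤)

module _ {n m : ℕ} .{{_ : NonZero n}} .{{_ : NonZero m}} (M : Matrix n m) (d N L : ℕ) .{{_ : NonZero N}} where
  private
    κ = 2 + L
    samples = 2 * N * (κ + κ)
    instance
      2N≢0 : NonZero (2 * N)
      2N≢0 = ℕ.m*n≢0 2 N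
  open Tester {n} {m} (verdict d κ) samples

  -- Every `2 * N` draws halve the potential, so `samples` draws halve it `κ + κ` times. Of these,
  -- `κ` halvings pay for the threshold, and the other `2 + L` for the `2 ^ L` hypotheses, which
  -- leaves ¼.
  test-sound : ∀ {r} (st : State n m r) → length (elements (hypotheses d r)) ≤ 2 ^ L →
    (∀ h → 1ℚ ℚ.≤ ι N ℚ.* missProbability M {d} st h) → Pr[ test samples st [] accepts M ] ℚ.≤ + 1 / 3
  test-sound {r} st size≤ far = ℚ.*-cancelˡ-≤-pos (½ Exp.^ κ) {{½^-positive κ}} (begin
    ½ Exp.^ κ ℚ.* Pr[ test samples st [] accepts M ]
      ≤⟨ test-potential M d κ samples st 0≤q ½^miss≤q samples [] ⟩
    q Exp.^ samples ℚ.* potential M d κ samples st []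
      ≤⟨ *-mono-≤ (^-nonNeg samples 0≤q) (potential-[] M d κ samples st {L} size≤) ⟩
    q Exp.^ samples ℚ.* ι (2 ^ L)
      ≡⟨ cong (ℚ._* ι (2 ^ L)) (Exp.^-assocʳ q (2 * N) (κ + κ)) ⟨
    (q Exp.^ (2 * N)) Exp.^ (κ + κ) ℚ.* ι (2 ^ L)
      ≤⟨ ℚ.*-monoʳ-≤-nonNeg (ι (2 ^ L)) {{ℚ.nonNegative (ι≥0 (2 ^ L))}} (^-mono (κ + κ) (^-nonNeg (2 * N) 0≤q) q^2N≤½) ⟩
    ½ Exp.^ (κ + κ) ℚ.* ι (2 ^ L)
      ≡⟨ cong (ℚ._* ι (2 ^ L)) (Exp.^-homo-* ½ κ κ) ⟩
    (½ Exp.^ κ ℚ.* ½ Exp.^ κ) ℚ.* ι (2 ^ L)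
      ≡⟨ solve 4 (λ a h l i → (a :* (h :* (h :* l))) :* i := a :* ((h :* h) :* (l :* i))) refl (½ Exp.^ κ) ½ (½ Exp.^ L) (ι (2 ^ L)) ⟩
    ½ Exp.^ κ ℚ.* ((½ ℚ.* ½) ℚ.* (½ Exp.^ L ℚ.* ι (2 ^ L)))
      ≡⟨ cong (λ y → ½ Exp.^ κ ℚ.* ((½ ℚ.* ½) ℚ.* y)) (½^-*-2^ L) ⟩
    ½ Exp.^ κ ℚ.* ((½ ℚ.* ½) ℚ.* 1ℚ)
      ≤⟨ *-mono-≤ (^-nonNeg κ ½≥0) (ℚ.≤ᵇ⇒≤ {(½ ℚ.* ½) ℚ.* 1ℚ} {+ 1 / 3} _) ⟩
    ½ Exp.^ κ ℚ.* (+ 1 / 3) ∎)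
    where
    open ℚ.≤-Reasoning
    x q : ℚ
    x = + 1 / (2 * N)
    q = 1ℚ ℚ.- x
    0≤x : 0ℚ ℚ.≤ x
    0≤x = 1/≥0 (2 * N)
    x*2N : x ℚ.* ι (2 * N) ≡ 1ℚ
    x*2N = /-*-ι (+ 1) (2 * N)
    x≤1 : x ℚ.≤ 1ℚ
    x≤1 = begin
      x                 ≡⟨ ℚ.*-identityʳ x ⟨
      x ℚ.* ι 1         ≤⟨ *-mono-≤ 0≤x (ι-mono (ℕ.>-nonZero⁻¹ (2 * N))) ⟩
      x ℚ.* ι (2 * N)   ≡⟨ x*2N ⟩
      1ℚ                ∎
    0≤q : 0ℚ ℚ.≤ q
    0≤q = ≡-≤-trans (sym (ℚ.+-inverseʳ x)) (ℚ.+-monoˡ-≤ (ℚ.- x) x≤1)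
    q^2N≤½ : q Exp.^ (2 * N) ℚ.≤ ½
    q^2N≤½ = begin
      q Exp.^ (2 * N)
        ≡⟨ solve 1 (λ y → y := con ½ :* (y :* (con 1ℚ :+ con 1ℚ))) refl (q Exp.^ (2 * N)) ⟩
      ½ ℚ.* (q Exp.^ (2 * N) ℚ.* (1ℚ ℚ.+ 1ℚ))
        ≡⟨ cong (λ y → ½ ℚ.* (q Exp.^ (2 * N) ℚ.* (1ℚ ℚ.+ y))) (trans (ℚ.*-comm (ι (2 * N)) x) x*2N) ⟨
      ½ ℚ.* (q Exp.^ (2 * N) ℚ.* (1ℚ ℚ.+ ι (2 * N) ℚ.* x))
        ≤⟨ *-mono-≤ ½≥0 (bernoulli 0≤x x≤1 (2 * N)) ⟩
      ½ ℚ.* 1ℚ ∎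
    -- With miss probability `p` the average is 1 - p/2, and `far` gives p ≥ 1/N.
    ½^miss≤q : ∀ h → avg₂ (λ i j → ½ Exp.^ bit (miss h (observe M st i j))) ℚ.≤ q
    ½^miss≤q h = begin
      avg₂ (λ i j → ½ Exp.^ bit (miss h (observe M st i j)))
        ≡⟨ avg₂-cong (λ i j → trans (½^bit (miss h (observe M st i j)))
             (solve 1 (λ y → con 1ℚ :- con ½ :* y := con 1ℚ :+ con (ℚ.- ½) :* y) refl (𝟙 (miss h (observe M st i j))))) ⟩
      avg₂ (λ i j → 1ℚ ℚ.+ (ℚ.- ½) ℚ.* 𝟙 (miss h (observe M st i j)))
        ≡⟨ avg₂-+ (λ _ _ → 1ℚ) (λ i j → (ℚ.- ½) ℚ.* 𝟙 (miss h (observe M st i j))) ⟩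
      avg₂ {n} {m} (λ _ _ → 1ℚ) ℚ.+ avg₂ (λ i j → (ℚ.- ½) ℚ.* 𝟙 (miss h (observe M st i j)))
        ≡⟨ cong₂ ℚ._+_ (avg₂-const {n} {m} 1ℚ) (avg₂-* (ℚ.- ½) (λ i j → 𝟙 (miss h (observe M st i j)))) ⟩
      1ℚ ℚ.+ (ℚ.- ½) ℚ.* p
        ≡⟨ cong (λ y → 1ℚ ℚ.+ (ℚ.- ½) ℚ.* y) (trans (sym (ℚ.*-identityˡ p)) (cong (ℚ._* p) (sym x*2N))) ⟩
      1ℚ ℚ.+ (ℚ.- ½) ℚ.* (x ℚ.* ι (2 * N) ℚ.* p)
        ≡⟨ cong (λ y → 1ℚ ℚ.+ (ℚ.- ½) ℚ.* (x ℚ.* y ℚ.* p)) (ι-* 2 N) ⟩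
      1ℚ ℚ.+ (ℚ.- ½) ℚ.* (x ℚ.* (ι 2 ℚ.* ι N) ℚ.* p)
        ≡⟨ solve 3 (λ x y p → con 1ℚ :+ con (ℚ.- ½) :* (x :* (con (ι 2) :* y) :* p) := con 1ℚ :- x :* (y :* p)) refl x (ι N) p ⟩
      1ℚ ℚ.- x ℚ.* (ι N ℚ.* p)
        ≤⟨ ℚ.+-monoʳ-≤ 1ℚ (ℚ.neg-antimono-≤ (*-mono-≤ 0≤x (far h))) ⟩
      1ℚ ℚ.- x ℚ.* 1ℚ
        ≡⟨ cong (λ y → 1ℚ ℚ.- y) (ℚ.*-identityʳ x) ⟩
      q ∎
      where p = missProbability M st h

-- `BinaryRankAtMost` asks for the least inner dimension, which strong induction finds up to double
-- negation. That suffices where it is used, since the goal there is a negation.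
¬¬-binaryRank≤ : ∀ {n m d} (M : Matrix n m) → Factorization M d → ¬ ¬ BinaryRankAtMost d M
¬¬-binaryRank≤ {d = d} M F ¬rank = no-factorization d ℕ.≤-refl F
  where
  no-factorization : ∀ k → k ≤ d → ¬ Factorization M k
  no-factorization = <-rec _ λ k rec k≤d F →
    ¬rank (k , (F , λ l F′ → ℕ.≮⇒≥ λ l<k → rec l<k (ℕ.≤-trans (ℕ.<⇒≤ l<k) k≤d) F′) , k≤d)

fromBool : Bool → Bit
fromBool false = zero
fromBool true  = suc zero

bit-toBool : ∀ b → bit (toBool b) ≡ toℕ b
bit-toBool zero       = refl
bit-toBool (suc zero) = refl

∙-sum : ∀ {k} (a b : Vec Bool k) →
        + (a ∙ b) ≡ ℤSum.sum (λ l → toℤ (fromBool (lookup a l)) ℤ.* toℤ (fromBool (lookup b l)))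
∙-sum []       []       = refl
∙-sum (a ∷ as) (b ∷ bs) = cong₂ ℤ._+_ (bit-* a b) (∙-sum as bs)
  where
  bit-* : ∀ a b → + bit (a ∧ b) ≡ toℤ (fromBool a) ℤ.* toℤ (fromBool b)
  bit-* true  true  = refl
  bit-* true  false = refl
  bit-* false true  = refl
  bit-* false false = refl

length-filter-tabulate : ∀ {A : Set} {P : A → Set} (P? : Decidable P) {k} (f : Fin k → A) →
  ι (length (filter P? (tabulate f))) ≡ ℚSum.sum (λ i → 𝟙 (does (P? (f i))))
length-filter-tabulate P? {zero}  f = refl
length-filter-tabulate P? {suc k} f with does (P? (f zero))
... | true  = cong (1ℚ ℚ.+_) (length-filter-tabulate P? (f ∘ suc))
... | false = trans (length-filter-tabulate P? (f ∘ suc)) (sym (ℚ.+-identityˡ _))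

length-filter-cartesianProduct : ∀ {A B : Set} {P : A × B → Set} (P? : Decidable P) {k l} (f : Fin k → A) (g : Fin l → B) →
  ι (length (filter P? (cartesianProduct (tabulate f) (tabulate g))))
    ≡ ℚSum.sum (λ i → ℚSum.sum (λ j → 𝟙 (does (P? (f i , g j)))))
length-filter-cartesianProduct P? {zero}  f g = refl
length-filter-cartesianProduct P? {suc k} f g = begin
  ι (length (filter P? (map (f zero ,_) (tabulate g) ++ rest)))
    ≡⟨ cong (ι ∘ length) (List.filter-++ P? (map (f zero ,_) (tabulate g)) rest) ⟩
  ι (length (filter P? (map (f zero ,_) (tabulate g)) ++ filter P? rest))
    ≡⟨ cong ι (List.length-++ (filter P? (map (f zero ,_) (tabulate g)))) ⟩
  ι (length (filter P? (map (f zero ,_) (tabulate g))) + length (filter P? rest))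
    ≡⟨ ι-+ (length (filter P? (map (f zero ,_) (tabulate g)))) _ ⟩
  ι (length (filter P? (map (f zero ,_) (tabulate g)))) ℚ.+ ι (length (filter P? rest))
    ≡⟨ cong₂ ℚ._+_ (trans (cong (ι ∘ length ∘ filter P?) (List.map-tabulate g (f zero ,_))) (length-filter-tabulate P? (λ j → f zero , g j)))
         (length-filter-cartesianProduct P? (f ∘ suc) g) ⟩
  ℚSum.sum (λ i → ℚSum.sum (λ j → 𝟙 (does (P? (f i , g j))))) ∎
  where
  open ≡-Reasoning
  rest = cartesianProduct (tabulate (f ∘ suc)) (tabulate g)

module _ {n m : ℕ} .{{_ : NonZero n}} .{{_ : NonZero m}} (M : Matrix n m) where

  dist≡avg₂ : ∀ M′ → dist M M′ ≡ avg₂ (λ i j → 𝟙 (does (¬? (M i j Fin.≟ M′ i j))))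
  dist≡avg₂ M′ = *-cancelʳ (ι (n * m)) {{ι-positive (n * m)}} (begin
    dist M M′ ℚ.* ι (n * m)
      ≡⟨ /-*-ι (+ length (differences M M′)) (n * m) ⟩
    + length (differences M M′) / 1
      ≡⟨ /1≡ι (length (differences M M′)) ⟩
    ι (length (differences M M′))
      ≡⟨ length-filter-cartesianProduct (λ (i , j) → ¬? (M i j Fin.≟ M′ i j)) id id ⟩
    ℚSum.sum (λ i → ℚSum.sum (δ i))
      ≡⟨ ι-*-avg (λ i → ℚSum.sum (δ i)) ⟨
    ι n ℚ.* avg n (λ i → ℚSum.sum (δ i))
      ≡⟨ cong (ι n ℚ.*_) (avg-cong λ i → sym (ι-*-avg (δ i))) ⟩
    ι n ℚ.* avg n (λ i → ι m ℚ.* avg m (δ i))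
      ≡⟨ cong (ι n ℚ.*_) (avg-* (ι m) (λ i → avg m (δ i))) ⟩
    ι n ℚ.* (ι m ℚ.* avg₂ δ)
      ≡⟨ solve 3 (λ a b c → a :* (b :* c) := c :* (a :* b)) refl (ι n) (ι m) (avg₂ δ) ⟩
    avg₂ δ ℚ.* (ι n ℚ.* ι m)
      ≡⟨ cong (avg₂ δ ℚ.*_) (ι-* n m) ⟨
    avg₂ δ ℚ.* ι (n * m) ∎)
    where
    open ≡-Reasoning
    instance
      nm≢0 : NonZero (n * m)
      nm≢0 = ℕ.m*n≢0 n m
    δ : Fin n → Fin m → ℚ
    δ i j = 𝟙 (does (¬? (M i j Fin.≟ M′ i j)))
    *-cancelʳ : ∀ {p q} r → {{ℚ.Positive r}} → p ℚ.* r ≡ q ℚ.* r → p ≡ q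
    *-cancelʳ r eq = ℚ.≤-antisym (ℚ.*-cancelʳ-≤-pos r (ℚ.≤-reflexive eq)) (ℚ.*-cancelʳ-≤-pos r (ℚ.≤-reflexive (sym eq)))

  module _ {d r : ℕ} (st : State n m r) (h : Hypothesis d r) where

    private
      left : Fin n → Vec Bool d
      left i = leftFactor h (rowType M st i)
      right : Fin m → Vec Bool d
      right j = rightFactor h (colType M st j)

    predicted : Matrix n m
    predicted i j = fromℕ< (s≤s (prediction≤1 h (rowType M st i) (colType M st j)))

    predicted-factorization : Factorization predicted d
    predicted-factorization = (λ i → fromBool ∘ lookup (left i)) , (λ l j → fromBool (lookup (right j) l)) ,
      λ i j → trans (cong +_ (Fin.toℕ-fromℕ< _)) (∙-sum (left i) (right j))

    dist≤missProbability : dist M predicted ℚ.≤ missProbability M st h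
    dist≤missProbability = ≡-≤-trans (dist≡avg₂ predicted) (avg₂-mono mismatch)
      where
      mismatch : ∀ i j → 𝟙 (does (¬? (M i j Fin.≟ predicted i j))) ℚ.≤ 𝟙 (miss h (observe M st i j))
      mismatch i j = 𝟙-does-mono (¬? (M i j Fin.≟ predicted i j)) (¬? (left i ∙ right j ℕ.≟ bit (entry M i j)))
        λ neq eq → neq (Fin.toℕ-injective (sym (trans (Fin.toℕ-fromℕ< _) (trans eq (bit-toBool (M i j))))))

    -- The predictions of `h` form a matrix of binary rank at most `d`, which is therefore not
    -- within 1/N < ε of `M`, and each position where it differs from `M` is a miss.
    far⇒missProbability : ∀ {ε} N .{{_ : NonZero N}} → (+ 1 / N) ℚ<ℝ ε → M IsFarFromBinaryRankAtMost d [ ε ] →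
                          1ℚ ℚ.≤ ι N ℚ.* missProbability M st h
    far⇒missProbability {ε} N 1/N<ε far = begin
      1ℚ                              ≡⟨ trans (ℚ.*-comm (ι N) (+ 1 / N)) (/-*-ι (+ 1) N) ⟨
      ι N ℚ.* (+ 1 / N)               ≤⟨ *-mono-≤ (ι≥0 N) (ℚ.≮⇒≥ ε≰dist) ⟩
      ι N ℚ.* dist M predicted        ≤⟨ *-mono-≤ (ι≥0 N) dist≤missProbability ⟩
      ι N ℚ.* missProbability M st h  ∎
      where
      open ℚ.≤-Reasoning
      ε≰dist : ¬ (dist M predicted ℚ.< + 1 / N)
      ε≰dist dist<1/N = ¬¬-binaryRank≤ predicted predicted-factorization λ rank≤d →
        far predicted rank≤d (Equivalence.from (ℝ.L-rounded ε (dist M predicted)) (+ 1 / N , dist<1/N , 1/N<ε))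

-- Completeness

module _ {n m : ℕ} (M : Matrix n m) where

  residual-initial : ∀ {d} (A : Fin n → Vec Bool d) (B : Fin m → Vec Bool d) →
    (∀ i j → A i ∙ B j ≡ bit (entry M i j)) → 𝔽₂Rank≤ (residual M initial) d
  residual-initial A B AB≡M = A , B , λ i j → trans (Bool.xor-identityʳ (entry M i j)) (sym (∙⇒⊙ (A i) (B j) (AB≡M i j)))

  -- The two new type bits are the residuals in the pivot column and in the pivot row, so the new
  -- residual is the Schur complement of the old one.
  residual-pivot : ∀ {r} (st : State n m r) {f} i₀ j₀ → residual M st i₀ j₀ ≡ true → 𝔽₂Rank≤ (residual M st) (suc f) →
    𝔽₂Rank≤ (residual M (pivot i₀ j₀ (rowType M st i₀) (colType M st j₀) st)) f
  residual-pivot st {f} i₀ j₀ E₀≡true rank≤ with 𝔽₂Rank≤-schur f i₀ j₀ E₀≡true rank≤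
  ... | A , G , schur≡AG = A , G , λ i j → trans
    (⊕-solve 3 (λ m e x → m ⊕ (e ⊕ x) ⊜ (m ⊕ x) ⊕ e) refl
      (entry M i j) (residual M st i j₀ ∧ residual M st i₀ j) (rowType M st i ⊙ colType M st j))
    (schur≡AG i j)
    where open BoolSolver.xor-∧-Solver renaming (solve to ⊕-solve; _:+_ to _⊕_; _:=_ to _⊜_)

module _ {d r : ℕ} {Q : Vec Bool d → Set} (Q? : Decidable Q) {J : Set} (js : List J) {j₁ : J} (j₁∈js : j₁ ∈ js)
         (w : J → Vec Bool d) (y : J → Vec Bool r) where

  opaque
    sampleIndices : Vec J d
    sampleIndices = proj₁ (determining js j₁∈js w)

    sampleIndices⊆ : ∀ l → lookup sampleIndices l ∈ js
    sampleIndices⊆ = proj₁ (proj₂ (determining js j₁∈js w))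

    sampleIndices-determine : ∀ a b → (∀ l → a ∙ w (lookup sampleIndices l) ≡ b ∙ w (lookup sampleIndices l)) →
                              ∀ {j} → j ∈ js → a ∙ w j ≡ b ∙ w j
    sampleIndices-determine = proj₂ (proj₂ (determining js j₁∈js w))

  constraints : Vec (Vec Bool r × Vec Bool d) d
  constraints = Vec.map (λ j → y j , w j) sampleIndices

  constraint : ∀ l → lookup constraints l ≡ (y (lookup sampleIndices l) , w (lookup sampleIndices l))
  constraint l = Vec.lookup-map l (λ j → y j , w j) sampleIndices

  -- The vector `a` witnesses that the search succeeds. What it finds may differ from `a`, but has
  -- the same products with the sampled vectors, which determine all products over `js`.
  decode-∙ : ∀ a x → Q a → (∀ l → a ∙ w (lookup sampleIndices l) ≡ bit (x ⊙ y (lookup sampleIndices l))) →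
             ∀ {j} → j ∈ js → decode Q? constraints x ∙ w j ≡ a ∙ w j
  decode-∙ a x Qa agrees = sampleIndices-determine (decode Q? constraints x) a λ l →
    trans (unpack (decode Q? constraints x) (constraint l) (decode-agrees Q? constraints x Qa (λ l → pack (constraint l) (agrees l)) l))
          (sym (agrees l))
    where
    pack : ∀ {c : Vec Bool r × Vec Bool d} {y w} → c ≡ (y , w) → a ∙ w ≡ bit (x ⊙ y) → a ∙ proj₂ c ≡ bit (x ⊙ proj₁ c)
    pack refl eq = eq
    unpack : ∀ a′ {c : Vec Bool r × Vec Bool d} {y w} → c ≡ (y , w) → a′ ∙ proj₂ c ≡ bit (x ⊙ proj₁ c) → a′ ∙ w ≡ bit (x ⊙ y)
    unpack a′ refl eq = eq

xor≡false : ∀ {a b} → a xor b ≡ false → a ≡ b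
xor≡false {true}  {true}  _ = refl
xor≡false {false} {false} _ = refl

extend : ∀ {A : Set} {k} → A → (Fin k → A) → Maybe (Fin k) → A
extend a f nothing  = a
extend a f (just i) = f i

-- The dummy `nothing` keeps the list inhabited when no index satisfies `P`. It will carry the zero
-- vector and the zero type, for which the prediction 0 is correct.
maybes : ∀ {k} {P : Fin k → Set} → Decidable P → List (Maybe (Fin k))
maybes {k} P? = nothing ∷ map just (filter P? (allFin k))

∈-maybes⁺ : ∀ {k} {P : Fin k → Set} (P? : Decidable P) {i} → P i → just i ∈ maybes P?
∈-maybes⁺ P? {i} Pi = there (∈.∈-map⁺ just (∈.∈-filter⁺ P? (∈.∈-allFin i) Pi))

∈-maybes⁻ : ∀ {k} {P : Fin k → Set} (P? : Decidable P) {i} → just i ∈ maybes P? → P i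
∈-maybes⁻ {k} P? (there i∈) with ∈.∈-map⁻ just i∈
... | _ , i∈filter , refl = proj₂ (∈.∈-filter⁻ P? {xs = allFin k} i∈filter)

module _ {n m : ℕ} .{{_ : NonZero n}} .{{_ : NonZero m}} (M : Matrix n m) {d r : ℕ} (st : State n m r)
         (A : Fin n → Vec Bool d) (B : Fin m → Vec Bool d) (AB≡M : ∀ i j → A i ∙ B j ≡ bit (entry M i j)) (H : ℕ) where

  e : Fin n → Fin m → ℚ
  e i j = 𝟙 (residual M st i j)

  rowError : Fin n → ℚ
  rowError i = avg m (e i)

  colError : Fin m → ℚ
  colError j = avg n λ i → e i j

  GoodCol : Fin m → Set
  GoodCol j = ι H ℚ.* colError j ℚ.≤ 1ℚ

  goodCol? : Decidable GoodCol
  goodCol? j = ι H ℚ.* colError j ℚ.≤? 1ℚ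

  Together : Fin d → Fin d → Set
  Together l l′ = ∃[ i ] (lookup (A i) l ≡ true × lookup (A i) l′ ≡ true)

  together? : ∀ l l′ → Dec (Together l l′)
  together? l l′ = Fin.any? λ i → (lookup (A i) l Bool.≟ true) ×-dec (lookup (A i) l′ Bool.≟ true)

  -- The pairs of distinct inner indices that it joins are exactly those forced by making every row
  -- of `A` a clique.
  support : Vec (Vec Bool d) d
  support = Vec.tabulate λ l → Vec.tabulate λ l′ → does (together? l l′)

  edge≡together : ∀ l l′ → lookup (lookup support l) l′ ≡ does (together? l l′)
  edge≡together l l′ = trans (cong (λ v → lookup v l′) (Vec.lookup∘tabulate _ l)) (Vec.lookup∘tabulate _ l′)

  A-clique : ∀ i → Clique support (A i)
  A-clique i l l′ _ l∈A l′∈A = trans (edge≡together l l′) (dec-true (together? l l′) (i , l∈A , l′∈A))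

  -- If a column of `B` contained two joined indices, the row of `A` that joins them would give an
  -- entry of at least 2.
  B-independent : ∀ j → Independent support (B j)
  B-independent j l l′ l≢l′ l∈B l′∈B edge = disjoint (holds (together? l l′) (trans (sym (edge≡together l l′)) edge))
    where
    holds : ∀ {P : Set} (P? : Dec P) → does P? ≡ true → P
    holds (yes p) _ = p
    disjoint : ¬ Together l l′
    disjoint (i , l∈A , l′∈A) = ℕ.<-irrefl refl (ℕ.≤-trans (2≤∙ (A i) (B j) l l′ l≢l′ (l∈A , l∈B) (l′∈A , l′∈B))
      (ℕ.≤-trans (ℕ.≤-reflexive (AB≡M i j)) (bit≤1 (entry M i j))))

  cols : List (Maybe (Fin m))
  cols = maybes goodCol?

  colVector : Maybe (Fin m) → Vec Bool d
  colVector = extend ∅ B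

  colType′ : Maybe (Fin m) → Vec Bool r
  colType′ = extend (Vec.replicate r false) (colType M st)

  t : Vec (Maybe (Fin m)) d
  t = sampleIndices (clique? support) cols (here refl) colVector colType′

  ts : Vec (Vec Bool r × Vec Bool d) d
  ts = constraints (clique? support) cols (here refl) colVector colType′

  A′ : Fin n → Vec Bool d
  A′ i = decode (clique? support) ts (rowType M st i)

  errorAtCol : Fin n → Maybe (Fin m) → Bool
  errorAtCol i = extend false (residual M st i)

  RowFits : Fin n → Set
  RowFits i = ∀ l → errorAtCol i (lookup t l) ≡ false

  -- When the predictions for row `i` are right at the sampled columns, `A i` meets the constraints,
  -- and the decoded row can replace it on all good columns.
  A′∙ : ∀ {i j} → RowFits i → GoodCol j → A′ i ∙ B j ≡ bit (entry M i j)
  A′∙ {i} {j} fits good = trans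
    (decode-∙ (clique? support) cols (here refl) colVector colType′ (A i) (rowType M st i) (A-clique i) (λ l → agrees (lookup t l) (fits l)) (∈-maybes⁺ goodCol? good))
    (AB≡M i j)
    where
    agrees : ∀ j → errorAtCol i j ≡ false → A i ∙ colVector j ≡ bit (rowType M st i ⊙ colType′ j)
    agrees nothing  _  = trans (∙-zeroʳ (A i)) (cong bit (sym (⊙-zeroʳ (rowType M st i))))
    agrees (just j) eq = trans (AB≡M i j) (cong bit (xor≡false eq))

  -- `RowFits i` makes `A′ i` reliable on good columns; the bound on the error keeps a sampled row
  -- from spoiling many columns.
  GoodRow : Fin n → Set
  GoodRow i = (ι H ℚ.* rowError i ℚ.≤ 1ℚ) × RowFits i

  goodRow? : Decidable GoodRow
  goodRow? i = (ι H ℚ.* rowError i ℚ.≤? 1ℚ) ×-dec Fin.all? (λ l → errorAtCol i (lookup t l) Bool.≟ false)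

  rows : List (Maybe (Fin n))
  rows = maybes goodRow?

  rowVector : Maybe (Fin n) → Vec Bool d
  rowVector = extend ∅ A′

  rowType′ : Maybe (Fin n) → Vec Bool r
  rowType′ = extend (Vec.replicate r false) (rowType M st)

  s : Vec (Maybe (Fin n)) d
  s = sampleIndices (independent? support) rows (here refl) rowVector rowType′

  ss : Vec (Vec Bool r × Vec Bool d) d
  ss = constraints (independent? support) rows (here refl) rowVector rowType′

  B′ : Fin m → Vec Bool d
  B′ j = decode (independent? support) ss (colType M st j)

  errorAtRow : Fin m → Maybe (Fin n) → Bool
  errorAtRow j = extend false (λ i → residual M st i j)

  ColFits : Fin m → Set
  ColFits j = ∀ l → errorAtRow j (lookup s l) ≡ false

  -- The argument of `A′∙` with rows and columns exchanged, applied to `A′` and `B` instead of `A`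
  -- and `B`. The sampled rows are good, so `A′∙` already gives their products with `B j`.
  A′∙B′ : ∀ {i j} → GoodRow i → GoodCol j → ColFits j → A′ i ∙ B′ j ≡ bit (entry M i j)
  A′∙B′ {i} {j} goodRow goodCol fits = trans (∙-comm (A′ i) (B′ j)) (trans
    (decode-∙ (independent? support) rows (here refl) rowVector rowType′ (B j) (colType M st j) (B-independent j)
      (λ l → agrees (lookup s l) (sampleIndices⊆ (independent? support) rows (here refl) rowVector rowType′ l) (fits l)) (∈-maybes⁺ goodRow? goodRow))
    (trans (∙-comm (B j) (A′ i)) (A′∙ (proj₂ goodRow) goodCol)))
    where
    agrees : ∀ i → i ∈ rows → errorAtRow j i ≡ false → B j ∙ rowVector i ≡ bit (colType M st j ⊙ rowType′ i)
    agrees nothing  _  _  = trans (∙-zeroʳ (B j)) (cong bit (sym (⊙-zeroʳ (colType M st j))))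
    agrees (just i) i∈ eq = trans (∙-comm (B j) (A′ i)) (trans (A′∙ (proj₂ (∈-maybes⁻ goodRow? i∈)) goodCol)
      (cong bit (trans (xor≡false eq) (⊙-comm (rowType M st i) (colType M st j)))))

  hypothesis : Hypothesis d r
  hypothesis = support , ts , ss

  rowMisfit : Fin n → ℚ
  rowMisfit i = ℚSum.sum λ l → 𝟙 (errorAtCol i (lookup t l))

  colMisfit : Fin m → ℚ
  colMisfit j = ℚSum.sum λ l → 𝟙 (errorAtRow j (lookup s l))

  -- A miss has one of four causes: a row or a column with too many errors, a wrong prediction for
  -- row `i` at a sampled column, or one for column `j` at a sampled row. Each cause makes its
  -- summand at least 1.
  misfit : Fin n → Fin m → ℚ
  misfit i j = (ι H ℚ.* rowError i ℚ.+ ι H ℚ.* colError j) ℚ.+ (rowMisfit i ℚ.+ colMisfit j)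

  private
    fits⊎1≤ : ∀ {k} (g : Fin k → Bool) → (∀ l → g l ≡ false) ⊎ (1ℚ ℚ.≤ ℚSum.sum (λ l → 𝟙 (g l)))
    fits⊎1≤ g with Fin.any? (λ l → g l Bool.≟ true)
    ... | yes (l , gl) = inj₂ (≡-≤-trans (sym (cong 𝟙 gl)) (term≤sum (λ l → 𝟙 (g l)) (λ l → 𝟙≥0 (g l)) l))
    ... | no ¬any      = inj₁ λ l → Bool.¬-not λ gl → ¬any (l , gl)

    summand₁ : ∀ {a b} → 0ℚ ℚ.≤ b → a ℚ.≤ a ℚ.+ b
    summand₁ {a} 0≤b = ≡-≤-trans (sym (ℚ.+-identityʳ a)) (ℚ.+-monoʳ-≤ a 0≤b)

    summand₂ : ∀ {a b} → 0ℚ ℚ.≤ a → b ℚ.≤ a ℚ.+ b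
    summand₂ {a} {b} 0≤a = ≡-≤-trans (sym (ℚ.+-identityˡ b)) (ℚ.+-monoˡ-≤ b 0≤a)

  miss≤misfit : ∀ i j → 𝟙 (miss hypothesis (observe M st i j)) ℚ.≤ misfit i j
  miss≤misfit i j = bound (ι H ℚ.* rowError i ℚ.≤? 1ℚ) (goodCol? j)
      (fits⊎1≤ λ l → errorAtCol i (lookup t l)) (fits⊎1≤ λ l → errorAtRow j (lookup s l))
    where
    0≤row : 0ℚ ℚ.≤ ι H ℚ.* rowError i
    0≤row = *-nonNeg (ι≥0 H) (avg-nonNeg λ j → 𝟙≥0 (residual M st i j))
    0≤col : 0ℚ ℚ.≤ ι H ℚ.* colError j
    0≤col = *-nonNeg (ι≥0 H) (avg-nonNeg λ i → 𝟙≥0 (residual M st i j))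
    0≤rowMisfit : 0ℚ ℚ.≤ rowMisfit i
    0≤rowMisfit = sum-nonNeg _ λ l → 𝟙≥0 (errorAtCol i (lookup t l))
    0≤colMisfit : 0ℚ ℚ.≤ colMisfit j
    0≤colMisfit = sum-nonNeg _ λ l → 𝟙≥0 (errorAtRow j (lookup s l))
    via : 1ℚ ℚ.≤ misfit i j → 𝟙 (miss hypothesis (observe M st i j)) ℚ.≤ misfit i j
    via = ℚ.≤-trans (𝟙≤1 (miss hypothesis (observe M st i j)))
    bound : Dec (ι H ℚ.* rowError i ℚ.≤ 1ℚ) → Dec (GoodCol j) → RowFits i ⊎ 1ℚ ℚ.≤ rowMisfit i → ColFits j ⊎ 1ℚ ℚ.≤ colMisfit j →
            𝟙 (miss hypothesis (observe M st i j)) ℚ.≤ misfit i j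
    bound (no bad) _ _ _ = via (ℚ.≤-trans (ℚ.<⇒≤ (ℚ.≰⇒> bad)) (ℚ.≤-trans (summand₁ 0≤col) (summand₁ (+-nonNeg 0≤rowMisfit 0≤colMisfit))))
    bound _ (no bad) _ _ = via (ℚ.≤-trans (ℚ.<⇒≤ (ℚ.≰⇒> bad)) (ℚ.≤-trans (summand₂ 0≤row) (summand₁ (+-nonNeg 0≤rowMisfit 0≤colMisfit))))
    bound _ _ (inj₂ bad) _ = via (ℚ.≤-trans bad (ℚ.≤-trans (summand₁ 0≤colMisfit) (summand₂ (+-nonNeg 0≤row 0≤col))))
    bound _ _ _ (inj₂ bad) = via (ℚ.≤-trans bad (ℚ.≤-trans (summand₂ 0≤rowMisfit) (summand₂ (+-nonNeg 0≤row 0≤col))))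
    bound (yes goodRow) (yes goodCol) (inj₁ rowFits) (inj₁ colFits) =
      ≡-≤-trans (cong (𝟙 ∘ not) (dec-true (A′ i ∙ B′ j ℕ.≟ bit (entry M i j)) (A′∙B′ (goodRow , rowFits) goodCol colFits)))
        (+-nonNeg (+-nonNeg 0≤row 0≤col) (+-nonNeg 0≤rowMisfit 0≤colMisfit))

  error : ℚ
  error = avg₂ e

  private
    -- Each of the `d` sampled columns is good or the dummy, so it errs on at most a fraction 1/H of
    -- the rows.
    avg-rowMisfit : ι H ℚ.* avg n rowMisfit ℚ.≤ ι d
    avg-rowMisfit = begin
      ι H ℚ.* avg n rowMisfit
        ≡⟨ cong (ι H ℚ.*_) (avg-sum λ i l → 𝟙 (errorAtCol i (lookup t l))) ⟩
      ι H ℚ.* ℚSum.sum (λ l → avg n λ i → 𝟙 (errorAtCol i (lookup t l)))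
        ≡⟨ ℚSum.*-distribˡ-sum (ι H) (λ l → avg n λ i → 𝟙 (errorAtCol i (lookup t l))) ⟩
      ℚSum.sum (λ l → ι H ℚ.* avg n λ i → 𝟙 (errorAtCol i (lookup t l)))
        ≤⟨ sum-mono (λ l → bound (lookup t l) (sampleIndices⊆ (clique? support) cols (here refl) colVector colType′ l)) ⟩
      ℚSum.sum {d} (λ _ → 1ℚ)
        ≡⟨ trans (sum-const d 1ℚ) (ℚ.*-identityʳ (ι d)) ⟩
      ι d ∎
      where
      open ℚ.≤-Reasoning
      bound : ∀ j → j ∈ cols → ι H ℚ.* avg n (λ i → 𝟙 (errorAtCol i j)) ℚ.≤ 1ℚ
      bound nothing  _  = ≡-≤-trans (trans (cong (ι H ℚ.*_) (avg-const {n} 0ℚ)) (ℚ.*-zeroʳ (ι H))) 0≤1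
      bound (just j) j∈ = ∈-maybes⁻ goodCol? j∈

    avg-colMisfit : ι H ℚ.* avg m colMisfit ℚ.≤ ι d
    avg-colMisfit = begin
      ι H ℚ.* avg m colMisfit
        ≡⟨ cong (ι H ℚ.*_) (avg-sum λ j l → 𝟙 (errorAtRow j (lookup s l))) ⟩
      ι H ℚ.* ℚSum.sum (λ l → avg m λ j → 𝟙 (errorAtRow j (lookup s l)))
        ≡⟨ ℚSum.*-distribˡ-sum (ι H) (λ l → avg m λ j → 𝟙 (errorAtRow j (lookup s l))) ⟩
      ℚSum.sum (λ l → ι H ℚ.* avg m λ j → 𝟙 (errorAtRow j (lookup s l)))
        ≤⟨ sum-mono (λ l → bound (lookup s l) (sampleIndices⊆ (independent? support) rows (here refl) rowVector rowType′ l)) ⟩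
      ℚSum.sum {d} (λ _ → 1ℚ)
        ≡⟨ trans (sum-const d 1ℚ) (ℚ.*-identityʳ (ι d)) ⟩
      ι d ∎
      where
      open ℚ.≤-Reasoning
      bound : ∀ i → i ∈ rows → ι H ℚ.* avg m (λ j → 𝟙 (errorAtRow j i)) ℚ.≤ 1ℚ
      bound nothing  _  = ≡-≤-trans (trans (cong (ι H ℚ.*_) (avg-const {m} 0ℚ)) (ℚ.*-zeroʳ (ι H))) 0≤1
      bound (just i) i∈ = proj₁ (∈-maybes⁻ goodRow? i∈)

    avg-misfit : avg₂ misfit ≡ (ι H ℚ.* error ℚ.+ ι H ℚ.* error) ℚ.+ (avg n rowMisfit ℚ.+ avg m colMisfit)
    avg-misfit = trans (avg₂-+ (λ i j → ι H ℚ.* rowError i ℚ.+ ι H ℚ.* colError j) (λ i j → rowMisfit i ℚ.+ colMisfit j))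
      (cong₂ ℚ._+_
        (trans (avg₂-+ (λ i j → ι H ℚ.* rowError i) (λ i j → ι H ℚ.* colError j)) (cong₂ ℚ._+_
          (trans (ofRows (λ i → ι H ℚ.* rowError i)) (avg-* (ι H) rowError))
          (trans (ofCols (λ j → ι H ℚ.* colError j)) (trans (avg-* (ι H) colError) (cong (ι H ℚ.*_) (sym (avg-comm e)))))))
        (trans (avg₂-+ (λ i j → rowMisfit i) (λ i j → colMisfit j)) (cong₂ ℚ._+_ (ofRows rowMisfit) (ofCols colMisfit))))
      where
      ofRows : ∀ (f : Fin n → ℚ) → avg₂ {n} {m} (λ i _ → f i) ≡ avg n f
      ofRows f = avg-cong λ i → avg-const (f i)
      ofCols : ∀ (f : Fin m → ℚ) → avg₂ {n} {m} (λ _ j → f j) ≡ avg m f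
      ofCols f = avg-const (avg m f)

  -- In other words p ≤ 2 H · error + 2 d / H: the first term counts the bad rows and columns by
  -- Markov's inequality, the second the wrong predictions at the samples.
  missProbability≤ : ι H ℚ.* missProbability M st hypothesis
                       ℚ.≤ (ι 2 ℚ.* (ι H ℚ.* ι H)) ℚ.* error ℚ.+ ι 2 ℚ.* ι d
  missProbability≤ = begin
    ι H ℚ.* missProbability M st hypothesis
      ≤⟨ *-mono-≤ (ι≥0 H) (avg₂-mono miss≤misfit) ⟩
    ι H ℚ.* avg₂ misfit
      ≡⟨ cong (ι H ℚ.*_) avg-misfit ⟩
    ι H ℚ.* ((ι H ℚ.* error ℚ.+ ι H ℚ.* error) ℚ.+ (avg n rowMisfit ℚ.+ avg m colMisfit))
      ≡⟨ solve 4 (λ h x a b → h :* ((h :* x :+ h :* x) :+ (a :+ b)) := (con (ι 2) :* (h :* h)) :* x :+ (h :* a :+ h :* b))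
           refl (ι H) error (avg n rowMisfit) (avg m colMisfit) ⟩
    (ι 2 ℚ.* (ι H ℚ.* ι H)) ℚ.* error ℚ.+ (ι H ℚ.* avg n rowMisfit ℚ.+ ι H ℚ.* avg m colMisfit)
      ≤⟨ ℚ.+-monoʳ-≤ ((ι 2 ℚ.* (ι H ℚ.* ι H)) ℚ.* error) (ℚ.+-mono-≤ avg-rowMisfit avg-colMisfit) ⟩
    (ι 2 ℚ.* (ι H ℚ.* ι H)) ℚ.* error ℚ.+ (ι d ℚ.+ ι d)
      ≡⟨ cong ((ι 2 ℚ.* (ι H ℚ.* ι H)) ℚ.* error ℚ.+_) (solve 1 (λ d → d :+ d := con (ι 2) :* d) refl (ι d)) ⟩
    (ι 2 ℚ.* (ι H ℚ.* ι H)) ℚ.* error ℚ.+ ι 2 ℚ.* ι d ∎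
    where open ℚ.≤-Reasoning

-- Rejection probability on matrices of small binary rank

ι-bit : ∀ b → ι (bit b) ≡ 𝟙 b
ι-bit true  = refl
ι-bit false = refl

module _ {n m : ℕ} .{{_ : NonZero n}} .{{_ : NonZero m}} (M : Matrix n m) (d κ samples : ℕ) where
  open Tester {n} {m} (verdict d κ) samples

  -- Markov's inequality: rejection means that every enumerated hypothesis, `h` included, has more
  -- than `κ` misses, and the right side is the expected final number of misses of `h`.
  test-markov : ∀ {r} (st : State n m r) (h : Hypothesis d r) s obs →
    ι κ ℚ.* Pr[ test s st obs rejects M ] ℚ.≤ ι (misses h obs) ℚ.+ ι s ℚ.* missProbability M st h
  test-markov {r} st h zero obs with any? (plausible? κ obs) (elements (hypotheses d r))
  ... | yes _ = ≡-≤-trans (ℚ.*-zeroʳ (ι κ))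
    (+-nonNeg (ι≥0 (misses h obs)) (ℚ.≤-reflexive (sym (ℚ.*-zeroˡ (missProbability M st h)))))
  ... | no ¬p = begin
    ι κ ℚ.* 1ℚ                  ≡⟨ ℚ.*-identityʳ (ι κ) ⟩
    ι κ                         ≤⟨ ι-mono (ℕ.<⇒≤ (ℕ.≰⇒> λ h≤κ → ¬p (lose (complete (hypotheses d r) h) h≤κ))) ⟩
    ι (misses h obs)            ≡⟨ ℚ.+-identityʳ (ι (misses h obs)) ⟨
    ι (misses h obs) ℚ.+ 0ℚ     ≡⟨ cong (ι (misses h obs) ℚ.+_) (ℚ.*-zeroˡ (missProbability M st h)) ⟨
    ι (misses h obs) ℚ.+ 0ℚ ℚ.* missProbability M st h ∎
    where open ℚ.≤-Reasoning
  test-markov st h (suc s) obs = begin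
    ι κ ℚ.* Pr[ test (suc s) st obs rejects M ]
      ≡⟨ cong (ι κ ℚ.*_) (Pr-drawPoint M st (λ _ _ o → test s st (o ∷ obs)) false) ⟩
    ι κ ℚ.* avg₂ (λ i j → Pr[ test s st (observe M st i j ∷ obs) rejects M ])
      ≡⟨ avg₂-* (ι κ) (λ i j → Pr[ test s st (observe M st i j ∷ obs) rejects M ]) ⟨
    avg₂ (λ i j → ι κ ℚ.* Pr[ test s st (observe M st i j ∷ obs) rejects M ])
      ≤⟨ avg₂-mono (λ i j → test-markov st h s (observe M st i j ∷ obs)) ⟩
    avg₂ (λ i j → ι (bit (miss h (observe M st i j)) + misses h obs) ℚ.+ ι s ℚ.* p)
      ≡⟨ avg₂-cong (λ i j → trans (cong (ℚ._+ ι s ℚ.* p) (trans (ι-+ (bit (miss h (observe M st i j))) (misses h obs))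
           (cong (ℚ._+ ι (misses h obs)) (ι-bit (miss h (observe M st i j))))))
           (ℚ.+-assoc (𝟙 (miss h (observe M st i j))) (ι (misses h obs)) (ι s ℚ.* p))) ⟩
    avg₂ (λ i j → 𝟙 (miss h (observe M st i j)) ℚ.+ (ι (misses h obs) ℚ.+ ι s ℚ.* p))
      ≡⟨ avg₂-+ (λ i j → 𝟙 (miss h (observe M st i j))) (λ _ _ → ι (misses h obs) ℚ.+ ι s ℚ.* p) ⟩
    p ℚ.+ avg₂ {n} {m} (λ _ _ → ι (misses h obs) ℚ.+ ι s ℚ.* p)
      ≡⟨ cong (p ℚ.+_) (avg₂-const {n} {m} (ι (misses h obs) ℚ.+ ι s ℚ.* p)) ⟩
    p ℚ.+ (ι (misses h obs) ℚ.+ ι s ℚ.* p)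
      ≡⟨ solve 3 (λ p x s → p :+ (x :+ s :* p) := x :+ (con 1ℚ :+ s) :* p) refl p (ι (misses h obs)) (ι s) ⟩
    ι (misses h obs) ℚ.+ ι (suc s) ℚ.* p ∎
    where
    open ℚ.≤-Reasoning
    p = missProbability M st h

module _ {n m : ℕ} .{{_ : NonZero n}} .{{_ : NonZero m}} (M : Matrix n m) (d N κ : ℕ)
         .{{_ : NonZero d}} .{{_ : NonZero N}} .{{_ : NonZero κ}}
         (A : Fin n → Vec Bool d) (B : Fin m → Vec Bool d) (AB≡M : ∀ i j → A i ∙ B j ≡ bit (entry M i j)) where
  private
    samples = 2 * N * (κ + κ)
    -- Markov's inequality bounds the probability that the test rejects by 4 N p, where p is
    -- the miss probability of the hypothesis; with this H, missProbability≤ becomes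
    -- 24 N p ≤ 1 + 6 Δ · error.
    Δ = 384 * (d * (N * N))
    H = 48 * (d * N)
  open Tester {n} {m} (verdict d κ) samples

  residualError : ∀ {r} → State n m r → ℚ
  residualError st = avg₂ λ i j → 𝟙 (residual M st i j)

  -- The rejection probability is at most 1/6 + Δ · error. The other 1/6 of the allowed 1/3 is left
  -- for the residual error at the random stopping time.
  test-complete : ∀ {r} (st : State n m r) →
    ι 6 ℚ.* Pr[ test samples st [] rejects M ] ℚ.≤ 1ℚ ℚ.+ ι 6 ℚ.* ι Δ ℚ.* residualError st
  test-complete st = ℚ.*-cancelˡ-≤-pos (ι d) {{ι-positive d}} (ℚ.*-cancelˡ-≤-pos (ι 2) {{ι-positive 2}} (ℚ.*-cancelˡ-≤-pos (ι κ) {{ι-positive κ}} (begin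
    ι κ ℚ.* (ι 2 ℚ.* (ι d ℚ.* (ι 6 ℚ.* φ)))
      ≡⟨ solve 5 (λ k a d b f → k :* (a :* (d :* (b :* f))) := (a :* d :* b) :* (k :* f)) refl (ι κ) (ι 2) (ι d) (ι 6) φ ⟩
    (ι 2 ℚ.* ι d ℚ.* ι 6) ℚ.* (ι κ ℚ.* φ)
      ≤⟨ *-mono-≤ (*-nonNeg (*-nonNeg (ι≥0 2) (ι≥0 d)) (ι≥0 6)) (test-markov M d κ samples st h samples []) ⟩
    (ι 2 ℚ.* ι d ℚ.* ι 6) ℚ.* (0ℚ ℚ.+ ι samples ℚ.* p)
      ≡⟨ cong (λ s → (ι 2 ℚ.* ι d ℚ.* ι 6) ℚ.* (0ℚ ℚ.+ s ℚ.* p)) ι-samples ⟩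
    (ι 2 ℚ.* ι d ℚ.* ι 6) ℚ.* (0ℚ ℚ.+ (ι 2 ℚ.* ι N) ℚ.* (ι κ ℚ.+ ι κ) ℚ.* p)
      ≡⟨ solve 4 (λ d N k p → (con (ι 2) :* d :* con (ι 6)) :* (con 0ℚ :+ (con (ι 2) :* N) :* (k :+ k) :* p)
                           := k :* ((con (ι 48) :* (d :* N)) :* p)) refl (ι d) (ι N) (ι κ) p ⟩
    ι κ ℚ.* ((ι 48 ℚ.* (ι d ℚ.* ι N)) ℚ.* p)
      ≡⟨ cong (λ x → ι κ ℚ.* (x ℚ.* p)) ι-H ⟨
    ι κ ℚ.* (ι H ℚ.* p)
      ≤⟨ *-mono-≤ (ι≥0 κ) (missProbability≤ M st A B AB≡M H) ⟩
    ι κ ℚ.* ((ι 2 ℚ.* (ι H ℚ.* ι H)) ℚ.* err ℚ.+ ι 2 ℚ.* ι d)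
      ≡⟨ cong (λ x → ι κ ℚ.* ((ι 2 ℚ.* (x ℚ.* x)) ℚ.* err ℚ.+ ι 2 ℚ.* ι d)) ι-H ⟩
    ι κ ℚ.* ((ι 2 ℚ.* ((ι 48 ℚ.* (ι d ℚ.* ι N)) ℚ.* (ι 48 ℚ.* (ι d ℚ.* ι N)))) ℚ.* err ℚ.+ ι 2 ℚ.* ι d)
      ≡⟨ cong (ι κ ℚ.*_) (solve 3 (λ d N e →
           (con (ι 2) :* ((con (ι 48) :* (d :* N)) :* (con (ι 48) :* (d :* N)))) :* e :+ con (ι 2) :* d
             := con (ι 2) :* (d :* (con 1ℚ :+ con (ι 6) :* (con (ι 384) :* (d :* (N :* N))) :* e)))
           refl (ι d) (ι N) err) ⟩
    ι κ ℚ.* (ι 2 ℚ.* (ι d ℚ.* (1ℚ ℚ.+ ι 6 ℚ.* (ι 384 ℚ.* (ι d ℚ.* (ι N ℚ.* ι N))) ℚ.* err)))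
      ≡⟨ cong (λ x → ι κ ℚ.* (ι 2 ℚ.* (ι d ℚ.* (1ℚ ℚ.+ ι 6 ℚ.* x ℚ.* err)))) ι-Δ ⟨
    ι κ ℚ.* (ι 2 ℚ.* (ι d ℚ.* (1ℚ ℚ.+ ι 6 ℚ.* ι Δ ℚ.* err))) ∎)))
    where
    open ℚ.≤-Reasoning
    h = hypothesis M st A B AB≡M H
    φ = Pr[ test samples st [] rejects M ]
    p = missProbability M st h
    err = residualError st
    ι-H : ι H ≡ ι 48 ℚ.* (ι d ℚ.* ι N)
    ι-H = trans (ι-* 48 (d * N)) (cong (ι 48 ℚ.*_) (ι-* d N))
    ι-Δ : ι Δ ≡ ι 384 ℚ.* (ι d ℚ.* (ι N ℚ.* ι N))
    ι-Δ = trans (ι-* 384 (d * (N * N))) (cong (ι 384 ℚ.*_) (trans (ι-* d (N * N)) (cong (ι d ℚ.*_) (ι-* N N))))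
    ι-samples : ι samples ≡ (ι 2 ℚ.* ι N) ℚ.* (ι κ ℚ.+ ι κ)
    ι-samples = trans (ι-* (2 * N) (κ + κ)) (cong₂ ℚ._*_ (ι-* 2 N) (ι-+ κ κ))

  rejections : ∀ {r} → ℕ → ℕ → State n m r → ℚ
  rejections P f st = ℚSum.sum {P} λ p → Pr[ eliminate (toℕ p) f st rejects M ]

  -- Each round that meets a nonzero residual lowers its rank, so the residual errors at
  -- the first P rounds add up to at most f in expectation.
  rejections≤ : ∀ {r} P f (st : State n m r) → 𝔽₂Rank≤ (residual M st) f →
    ι 6 ℚ.* rejections P f st ℚ.≤ ι P ℚ.+ ι 6 ℚ.* ι Δ ℚ.* ι f
  rejections≤ zero f st rank≤ = ≡-≤-trans (ℚ.*-zeroʳ (ι 6))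
    (+-nonNeg ℚ.≤-refl (*-nonNeg (*-nonNeg (ι≥0 6) (ι≥0 Δ)) (ι≥0 f)))
  rejections≤ {r} (suc P) f st rank≤ = begin
    ι 6 ℚ.* (φ ℚ.+ ℚSum.sum {P} λ p → Pr[ eliminate (suc (toℕ p)) f st rejects M ])
      ≡⟨ cong (λ x → ι 6 ℚ.* (φ ℚ.+ x)) (ℚSum.sum-cong-≗ {P} λ p → Pr-drawPoint M st (advance (toℕ p) f st) false) ⟩
    ι 6 ℚ.* (φ ℚ.+ ℚSum.sum {P} λ p → avg₂ λ i j → next i j p)
      ≡⟨ cong (λ x → ι 6 ℚ.* (φ ℚ.+ x)) (avg₂-sum next) ⟨
    ι 6 ℚ.* (φ ℚ.+ avg₂ λ i j → ℚSum.sum (next i j))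
      ≡⟨ ℚ.*-distribˡ-+ (ι 6) φ _ ⟩
    ι 6 ℚ.* φ ℚ.+ ι 6 ℚ.* (avg₂ λ i j → ℚSum.sum (next i j))
      ≡⟨ cong (ι 6 ℚ.* φ ℚ.+_) (avg₂-* (ι 6) (λ i j → ℚSum.sum (next i j))) ⟨
    ι 6 ℚ.* φ ℚ.+ (avg₂ λ i j → ι 6 ℚ.* ℚSum.sum (next i j))
      ≤⟨ ℚ.+-mono-≤ (test-complete st) (avg₂-mono λ i j → next≤ i j (residual M st i j) refl) ⟩
    (1ℚ ℚ.+ 6Δ ℚ.* err) ℚ.+ (avg₂ λ i j → (ι P ℚ.+ 6Δ ℚ.* ι f) ℚ.+ (ℚ.- 6Δ) ℚ.* 𝟙 (residual M st i j))
      ≡⟨ cong ((1ℚ ℚ.+ 6Δ ℚ.* err) ℚ.+_) (trans (avg₂-+ (λ _ _ → ι P ℚ.+ 6Δ ℚ.* ι f) (λ i j → (ℚ.- 6Δ) ℚ.* 𝟙 (residual M st i j)))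
           (cong₂ ℚ._+_ (avg₂-const {n} {m} (ι P ℚ.+ 6Δ ℚ.* ι f)) (avg₂-* (ℚ.- 6Δ) (λ i j → 𝟙 (residual M st i j))))) ⟩
    (1ℚ ℚ.+ 6Δ ℚ.* err) ℚ.+ ((ι P ℚ.+ 6Δ ℚ.* ι f) ℚ.+ (ℚ.- 6Δ) ℚ.* err)
      -- The charge `6Δ ℚ.* err` for stopping at this state cancels against the expected drop of
      -- `6Δ ℚ.* ι f` caused by a pivot in this round.
      ≡⟨ solve 4 (λ D e P f → (con 1ℚ :+ D :* e) :+ ((P :+ D :* f) :+ (:- D) :* e) := (con 1ℚ :+ P) :+ D :* f)
           refl 6Δ err (ι P) (ι f) ⟩
    ι (suc P) ℚ.+ 6Δ ℚ.* ι f ∎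
    where
    open ℚ.≤-Reasoning
    φ = Pr[ test samples st [] rejects M ]
    err = residualError st
    6Δ = ι 6 ℚ.* ι Δ
    next : Fin n → Fin m → Fin P → ℚ
    next i j p = Pr[ advance (toℕ p) f st i j (observe M st i j) rejects M ]
    next≤ : ∀ i j b → residual M st i j ≡ b →
            ι 6 ℚ.* ℚSum.sum (next i j) ℚ.≤ (ι P ℚ.+ 6Δ ℚ.* ι f) ℚ.+ (ℚ.- 6Δ) ℚ.* 𝟙 (residual M st i j)
    next≤ i j false eq = begin
      ι 6 ℚ.* ℚSum.sum (next i j)
        ≡⟨ cong (λ b → ι 6 ℚ.* ℚSum.sum {P} λ p → Pr[ step (toℕ p) f st i j (rowType M st i) (colType M st j) b rejects M ]) eq ⟩
      ι 6 ℚ.* rejections P f st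
        ≤⟨ rejections≤ P f st rank≤ ⟩
      ι P ℚ.+ 6Δ ℚ.* ι f
        ≡⟨ solve 2 (λ x D → x := x :+ (:- D) :* con 0ℚ) refl (ι P ℚ.+ 6Δ ℚ.* ι f) 6Δ ⟩
      (ι P ℚ.+ 6Δ ℚ.* ι f) ℚ.+ (ℚ.- 6Δ) ℚ.* 0ℚ
        ≡⟨ cong (λ b → (ι P ℚ.+ 6Δ ℚ.* ι f) ℚ.+ (ℚ.- 6Δ) ℚ.* 𝟙 b) eq ⟨
      (ι P ℚ.+ 6Δ ℚ.* ι f) ℚ.+ (ℚ.- 6Δ) ℚ.* 𝟙 (residual M st i j) ∎
    next≤ i j true eq = begin
      ι 6 ℚ.* ℚSum.sum (next i j)
        ≡⟨ cong (λ b → ι 6 ℚ.* ℚSum.sum {P} λ p → Pr[ step (toℕ p) f st i j (rowType M st i) (colType M st j) b rejects M ]) eq ⟩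
      ι 6 ℚ.* ℚSum.sum {P} (λ p → Pr[ step (toℕ p) f st i j (rowType M st i) (colType M st j) true rejects M ])
        ≤⟨ refined f rank≤ ⟩
      (ι P ℚ.+ 6Δ ℚ.* ι f) ℚ.+ (ℚ.- 6Δ) ℚ.* 1ℚ
        ≡⟨ cong (λ b → (ι P ℚ.+ 6Δ ℚ.* ι f) ℚ.+ (ℚ.- 6Δ) ℚ.* 𝟙 b) eq ⟨
      (ι P ℚ.+ 6Δ ℚ.* ι f) ℚ.+ (ℚ.- 6Δ) ℚ.* 𝟙 (residual M st i j) ∎
      where
      refined : ∀ f → 𝔽₂Rank≤ (residual M st) f →
        ι 6 ℚ.* ℚSum.sum {P} (λ p → Pr[ step (toℕ p) f st i j (rowType M st i) (colType M st j) true rejects M ])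
          ℚ.≤ (ι P ℚ.+ 6Δ ℚ.* ι f) ℚ.+ (ℚ.- 6Δ) ℚ.* 1ℚ
      -- Once no pivot is left, the residual has rank 0 and vanishes, so the tester never rejects
      -- for want of pivots here.
      refined zero rank≤0 with trans (sym (𝔽₂Rank≤0 rank≤0 i j)) eq
      ... | ()
      refined (suc f) rank≤ = ≤-≡-trans (rejections≤ P f _ (residual-pivot M st i j eq rank≤))
        (solve 3 (λ P D f → P :+ D :* f := (P :+ D :* (con 1ℚ :+ f)) :+ (:- D) :* con 1ℚ) refl (ι P) 6Δ (ι f))

  -- Chosen so that the residual errors, of total at most `d` in expectation, contribute Δ d /
  -- rounds = 1/6.
  rounds : ℕ
  rounds = 6 * (d * Δ)

  tester-complete : .{{_ : NonZero rounds}} → Pr[ tester rounds d rejects M ] ℚ.≤ + 1 / 3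
  tester-complete = ℚ.*-cancelˡ-≤-pos (ι rounds) {{ι-positive rounds}} (ℚ.*-cancelˡ-≤-pos (ι 6) {{ι-positive 6}} (begin
    ι 6 ℚ.* (ι rounds ℚ.* Pr[ tester rounds d rejects M ])
      ≡⟨ cong (λ x → ι 6 ℚ.* (ι rounds ℚ.* x)) (Pr-toss M rounds (λ p → eliminate (toℕ p) d initial) false) ⟩
    ι 6 ℚ.* (ι rounds ℚ.* avg rounds λ p → Pr[ eliminate (toℕ p) d initial rejects M ])
      ≡⟨ cong (ι 6 ℚ.*_) (ι-*-avg λ p → Pr[ eliminate (toℕ p) d initial rejects M ]) ⟩
    ι 6 ℚ.* rejections rounds d initial
      ≤⟨ rejections≤ rounds d initial (residual-initial M A B AB≡M) ⟩
    ι rounds ℚ.+ ι 6 ℚ.* ι Δ ℚ.* ι d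
      ≡⟨ cong (ι rounds ℚ.+_) (trans (solve 3 (λ a D d → a :* D :* d := a :* (d :* D)) refl (ι 6) (ι Δ) (ι d))
           (sym (trans (ι-* 6 (d * Δ)) (cong (ι 6 ℚ.*_) (ι-* d Δ))))) ⟩
    ι rounds ℚ.+ ι rounds
      ≡⟨ solve 1 (λ x → x :+ x := con (ι 6) :* (x :* con (+ 1 / 3))) refl (ι rounds) ⟩
    ι 6 ℚ.* (ι rounds ℚ.* (+ 1 / 3)) ∎))
    where open ℚ.≤-Reasoning

-- Scaling by a natural number

module _ (ε : ℝ) where
  open ℝ ε

  L-downward : ∀ {p q} → p ℚ.≤ q → L q → L p
  L-downward {p} {q} p≤q Lq with Equivalence.to (L-rounded q) Lq
  ... | q′ , q<q′ , Lq′ = Equivalence.from (L-rounded p) (q′ , ℚ.≤-<-trans p≤q q<q′ , Lq′)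

  ¬L⇒upper : ∀ {q} → ¬ L q → ∀ r → L r → r ℚ.≤ q
  ¬L⇒upper {q} ¬Lq r Lr = ℚ.≮⇒≥ λ q<r → ¬Lq (Equivalence.from (L-rounded q) (r , q<r , Lr))

  -- A number N with 1/N < ε ≤ 3/N. The factor 3 leaves the slack with which locatedness can decide
  -- when to stop the search.
  Scale : Set
  Scale = Σ[ N ∈ ℕ ] Σ[ N≢0 ∈ NonZero N ] (_/_ (+ 1) N {{N≢0}} ℚ<ℝ ε × (∀ r → L r → r ℚ.* ι N ℚ.≤ ι 3))

  1/k<3/1+k : ∀ k → + 1 / suc k ℚ.< + 3 / suc (suc k)
  1/k<3/1+k k = ℚ.toℚᵘ-cancel-<
    (ℚᵘ.<-respˡ-≃ (ℚᵘ.≃-sym (toℚᵘ-/ (+ 1) k)) (ℚᵘ.<-respʳ-≃ (ℚᵘ.≃-sym (toℚᵘ-/ (+ 3) (suc k)))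
    (ℚᵘ.*<* (subst₂ ℤ._<_ (ℤ.pos-* 1 (suc (suc k))) (ℤ.pos-* 3 (suc k)) (ℤ.+<+ (begin-strict
      1 * suc (suc k)            ≡⟨ ℕ.*-identityˡ (suc (suc k)) ⟩
      1 + suc k                  <⟨ ℕ.+-mono-<-≤ {1} {2} (s≤s (s≤s z≤n)) (ℕ.m≤m+n (suc k) k) ⟩
      2 + (suc k + k)            ≤⟨ ℕ.m≤m+n (2 + (suc k + k)) k ⟩
      2 + (suc k + k) + k        ≡⟨ NatSolver.solve 1 (λ k → NatSolver.con 2 NatSolver.:+ (NatSolver.con 1 NatSolver.:+ k NatSolver.:+ k) NatSolver.:+ k
                                      NatSolver.:= NatSolver.con 3 NatSolver.:* (NatSolver.con 1 NatSolver.:+ k)) refl k ⟩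
      3 * suc k                  ∎))))))
    where open ℕ.≤-Reasoning

  -- Descends from a denominator known to be large enough. Locatedness says that the next smaller
  -- one also works, or that ε < 3/N for the present one, where the search stops; at N = 1 the bound
  -- ε ≤ 1 takes over.
  scale-from : ∀ k → L (+ 1 / suc k) → ε ℝ≤ℚ 1ℚ → Scale
  scale-from zero L1 ε≤1 = 1 , _ , L1 , λ r Lr →
    ℚ.≤-trans (≡-≤-trans (ℚ.*-identityʳ r) (¬L⇒upper ε≤1 r Lr)) (ι-mono {1} {3} (s≤s z≤n))
  scale-from (suc k) L1/2+k ε≤1 with located (+ 1 / suc k) (+ 3 / suc (suc k)) (1/k<3/1+k k)
  ... | inj₁ L1/1+k = scale-from k L1/1+k ε≤1
  ... | inj₂ U3/2+k = suc (suc k) , _ , L1/2+k , λ r Lr →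
    ≤-≡-trans (ℚ.*-monoʳ-≤-nonNeg (ι (suc (suc k))) {{ℚ.nonNegative (ι≥0 (suc (suc k)))}}
        (¬L⇒upper (λ L3/2+k → disjoint (+ 3 / suc (suc k)) (L3/2+k , U3/2+k)) r Lr))
      (trans (/-*-ι (+ 3) (suc (suc k))) (/1≡ι 3))

  1/denominator≤ : ∀ q → 0ℚ ℚ.< q → + 1 / suc (ℚ.denominator-1 q) ℚ.≤ q
  1/denominator≤ q@(ℚ.mkℚ (+ suc a) d _) _ = ℚ.toℚᵘ-cancel-≤
    (ℚᵘ.≤-respˡ-≃ (ℚᵘ.≃-sym (toℚᵘ-/ (+ 1) d)) (ℚᵘ.*≤* (ℤ.*-monoʳ-≤-nonNeg (+ suc d) {+ 1} {+ suc a} (ℤ.+≤+ (s≤s z≤n)))))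
  1/denominator≤ (ℚ.mkℚ (+ zero) d _)  (ℚ.*<* (ℤ.+<+ ()))
  1/denominator≤ (ℚ.mkℚ ℤ.-[1+ a ] d _) (ℚ.*<* ())

  scale : 0ℚ ℚ<ℝ ε → ε ℝ≤ℚ 1ℚ → Scale
  scale 0<ε ε≤1 with Equivalence.to (L-rounded 0ℚ) 0<ε
  ... | q , 0<q , Lq = scale-from (ℚ.denominator-1 q) (L-downward (1/denominator≤ q 0<q) Lq) ε≤1

  -- N ≤ 3/ε, so replacing N² by 1/ε² costs a factor 9.
  scale-bound : ∀ N → (∀ r → L r → r ℚ.* ι N ℚ.≤ ι 3) → ∀ {a K b} → a ≤ K * b * (N * N) → a ≤ 9 * K * b /[ ε ]²
  scale-bound N r*N≤3 {a} {K} {b} a≤ r 0<r Lr = begin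
    (+ a / 1) ℚ.* (r ℚ.* r)
      ≡⟨ cong (ℚ._* (r ℚ.* r)) (/1≡ι a) ⟩
    ι a ℚ.* (r ℚ.* r)
      ≤⟨ ℚ.*-monoʳ-≤-nonNeg (r ℚ.* r) {{ℚ.nonNegative (*-nonNeg 0≤r 0≤r)}} (ι-mono a≤) ⟩
    ι (K * b * (N * N)) ℚ.* (r ℚ.* r)
      ≡⟨ cong (ℚ._* (r ℚ.* r)) (trans (ι-* (K * b) (N * N)) (cong₂ ℚ._*_ (ι-* K b) (ι-* N N))) ⟩
    (ι K ℚ.* ι b) ℚ.* (ι N ℚ.* ι N) ℚ.* (r ℚ.* r)
      ≡⟨ solve 4 (λ K b N r → (K :* b) :* (N :* N) :* (r :* r) := (K :* b) :* ((r :* N) :* (r :* N))) refl (ι K) (ι b) (ι N) r ⟩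
    (ι K ℚ.* ι b) ℚ.* ((r ℚ.* ι N) ℚ.* (r ℚ.* ι N))
      ≤⟨ *-mono-≤ (*-nonNeg (ι≥0 K) (ι≥0 b)) (*-mono₂-≤ 0≤rN (ι≥0 3) (r*N≤3 r Lr) (r*N≤3 r Lr)) ⟩
    (ι K ℚ.* ι b) ℚ.* (ι 3 ℚ.* ι 3)
      ≡⟨ solve 2 (λ K b → (K :* b) :* (con (ι 3) :* con (ι 3)) := con (ι 9) :* K :* b) refl (ι K) (ι b) ⟩
    ι 9 ℚ.* ι K ℚ.* ι b
      ≡⟨ trans (ι-* (9 * K) b) (cong (ℚ._* ι b) (ι-* 9 K)) ⟨
    ι (9 * K * b)
      ≡⟨ /1≡ι (9 * K * b) ⟨
    + (9 * K * b) / 1 ∎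
    where
    open ℚ.≤-Reasoning
    0≤r : 0ℚ ℚ.≤ r
    0≤r = ℚ.<⇒≤ 0<r
    0≤rN : 0ℚ ℚ.≤ r ℚ.* ι N
    0≤rN = *-nonNeg 0≤r (ι≥0 N)

-- From binary rank to Boolean factorizations

fromBool-toBool : ∀ b → fromBool (toBool b) ≡ b
fromBool-toBool zero       = refl
fromBool-toBool (suc zero) = refl

∙-padʳ : ∀ {k} (a b : Vec Bool k) l → (a Vec.++ Vec.replicate l false) ∙ (b Vec.++ Vec.replicate l false) ≡ a ∙ b
∙-padʳ []       []       l = ∙-zeroʳ (Vec.replicate l false)
∙-padʳ (a ∷ as) (b ∷ bs) l = cong (λ k → bit (a ∧ b) + k) (∙-padʳ as bs l)

BooleanFactorization : ∀ {n m} → Matrix n m → ℕ → Set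
BooleanFactorization {n} {m} M d =
  Σ[ A ∈ (Fin n → Vec Bool d) ] Σ[ B ∈ (Fin m → Vec Bool d) ] (∀ i j → A i ∙ B j ≡ bit (entry M i j))

-- A factorization of smaller inner dimension is padded with zeros to exactly `d`.
binaryRank⇒factorization : ∀ {n m} (M : Matrix n m) {d} → BinaryRankAtMost d M → BooleanFactorization M d
binaryRank⇒factorization M (r , ((A , B , M≡AB) , _) , r≤d) with ℕ.m≤n⇒∃[o]m+o≡n r≤d
... | l , refl = (λ i → a i Vec.++ Vec.replicate l false) , (λ j → b j Vec.++ Vec.replicate l false) , λ i j →
  trans (∙-padʳ (a i) (b j) l) (trans (ℤ.+-injective (trans (∙-sum (a i) (b j))
    (trans (ℤSum.sum-cong-≗ {r} λ k → cong₂ (λ x y → toℤ x ℤ.* toℤ y) (bits (A i) k) (bits (λ k → B k j) k)) (sym (M≡AB i j)))))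
    (sym (bit-toBool (M i j))))
  where
  a = λ i → Vec.tabulate (toBool ∘ A i)
  b = λ j → Vec.tabulate (λ k → toBool (B k j))
  bits : ∀ (f : Fin r → Bit) k → fromBool (lookup (Vec.tabulate (toBool ∘ f)) k) ≡ f k
  bits f k = trans (cong fromBool (Vec.lookup∘tabulate (toBool ∘ f) k)) (fromBool-toBool (f k))

2/3≤complement : ∀ {p q} → p ℚ.+ q ≡ 1ℚ → q ℚ.≤ + 1 / 3 → + 2 / 3 ℚ.≤ p
2/3≤complement {p} {q} p+q≡1 q≤1/3 = begin
  1ℚ ℚ.- + 1 / 3      ≤⟨ ℚ.+-monoʳ-≤ 1ℚ (ℚ.neg-antimono-≤ q≤1/3) ⟩
  1ℚ ℚ.- q            ≡⟨ cong (ℚ._- q) p+q≡1 ⟨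
  p ℚ.+ q ℚ.- q       ≡⟨ solve 2 (λ p q → p :+ q :- q := p) refl p q ⟩
  p                   ∎
  where open ℚ.≤-Reasoning

-- Choice of parameters and the query bound

opaque
  -- The rounds contribute `6 * 384`, the samples `2 * (7 + 7)`, and the factor 3 comes from the
  -- cost 2d + 1 ≤ 3d of a point.
  queryConstant : ℕ
  queryConstant = 3 * (6 * 384 + 2 * (7 + 7))

module Parameters (d N : ℕ) .{{_ : NonZero d}} .{{_ : NonZero N}} where

  -- `L` bounds the bits of a hypothesis: d² for the graph and at most 2d² for each of the two lists
  -- of constraints. `P` is the number of rounds and `S` the number of samples.
  L κ P S : ℕ
  L = 5 * (d * d)
  κ = 2 + L
  P = 6 * (d * (384 * (d * (N * N))))
  S = 2 * N * (κ + κ)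

  instance
    P≢0 : NonZero P
    P≢0 = ℕ.m*n≢0 6 _ {{_}} {{ℕ.m*n≢0 d _ {{it}} {{ℕ.m*n≢0 384 _ {{_}} {{ℕ.m*n≢0 d _ {{it}} {{ℕ.m*n≢0 N N}}}}}}}}

  hypotheses-size : ∀ {r} → r ≤ d → length (elements (hypotheses d r)) ≤ 2 ^ L
  hypotheses-size {r} r≤d = ℕ.≤-trans (size (hypotheses d r)) (ℕ.^-monoʳ-≤ 2 (begin
    d * (d * 1) + (d * (r * 1 + d * 1) + d * (r * 1 + d * 1))
      ≤⟨ ℕ.+-monoʳ-≤ (d * (d * 1)) (ℕ.+-mono-≤ pairs≤ pairs≤) ⟩
    d * (d * 1) + (d * (d * 1 + d * 1) + d * (d * 1 + d * 1))
      ≡⟨ NatSolver.solve 1 (λ d → d ⊗ (d ⊗ κ₁) ⊕ (d ⊗ (d ⊗ κ₁ ⊕ d ⊗ κ₁) ⊕ d ⊗ (d ⊗ κ₁ ⊕ d ⊗ κ₁)) ⊜ NatSolver.con 5 ⊗ (d ⊗ d)) refl d ⟩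
    5 * (d * d) ∎))
    where
    open ℕ.≤-Reasoning
    open NatSolver using () renaming (_:+_ to _⊕_; _:*_ to _⊗_; _:=_ to _⊜_)
    κ₁ = NatSolver.con 1
    pairs≤ : d * (r * 1 + d * 1) ≤ d * (d * 1 + d * 1)
    pairs≤ = ℕ.*-monoʳ-≤ d (ℕ.+-monoˡ-≤ (d * 1) (ℕ.*-monoˡ-≤ 1 r≤d))

  1≤d : 1 ≤ d
  1≤d = ℕ.>-nonZero⁻¹ d

  opaque
    unfolding queryConstant

    queries≤ : (P + S) * (d + suc d) ≤ queryConstant * (d ^ 3 * ⌊log₂ (d + 1) ⌋) * (N * N)
    queries≤ = begin
      (P + S) * (d + suc d)
        ≤⟨ ℕ.*-mono-≤ (ℕ.+-mono-≤ (ℕ.≤-reflexive (regroup 6 384 d (N * N))) S≤) pointCost≤ ⟩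
      (6 * 384 * (d * d * (N * N)) + 2 * (7 + 7) * (d * d * (N * N))) * (3 * d)
        ≡⟨ collect (6 * 384) (2 * (7 + 7)) 3 d (N * N) ⟩
      3 * (6 * 384 + 2 * (7 + 7)) * d ^ 3 * (N * N)
        ≤⟨ ℕ.*-monoˡ-≤ (N * N) (ℕ.*-monoʳ-≤ (3 * (6 * 384 + 2 * (7 + 7))) d³≤) ⟩
      3 * (6 * 384 + 2 * (7 + 7)) * (d ^ 3 * ⌊log₂ (d + 1) ⌋) * (N * N) ∎
      where
      open ℕ.≤-Reasoning
      open NatSolver using () renaming (_:+_ to _⊕_; _:*_ to _⊗_; _:=_ to _⊜_)
      regroup : ∀ a c d x → a * (d * (c * (d * x))) ≡ a * c * (d * d * x)
      regroup = NatSolver.solve 4 (λ a c d x → a ⊗ (d ⊗ (c ⊗ (d ⊗ x))) ⊜ a ⊗ c ⊗ (d ⊗ d ⊗ x)) refl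
      collect : ∀ u v w d x → (u * (d * d * x) + v * (d * d * x)) * (w * d) ≡ w * (u + v) * (d * (d * (d * 1))) * x
      collect = NatSolver.solve 5 (λ u v w d x → (u ⊗ (d ⊗ d ⊗ x) ⊕ v ⊗ (d ⊗ d ⊗ x)) ⊗ (w ⊗ d)
        ⊜ w ⊗ (u ⊕ v) ⊗ (d ⊗ (d ⊗ (d ⊗ NatSolver.con 1))) ⊗ x) refl
      κ≤ : κ ≤ 7 * (d * d)
      κ≤ = begin
        2 + 5 * (d * d)              ≤⟨ ℕ.+-monoˡ-≤ (5 * (d * d)) (ℕ.*-monoʳ-≤ 2 (ℕ.*-mono-≤ 1≤d 1≤d)) ⟩
        2 * (d * d) + 5 * (d * d)    ≡⟨ ℕ.*-distribʳ-+ (d * d) 2 5 ⟨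
        7 * (d * d)                  ∎
      S≤ : S ≤ 2 * (7 + 7) * (d * d * (N * N))
      S≤ = begin
        2 * N * (κ + κ)                                ≤⟨ ℕ.*-monoʳ-≤ (2 * N) (ℕ.+-mono-≤ κ≤ κ≤) ⟩
        2 * N * (7 * (d * d) + 7 * (d * d))            ≤⟨ ℕ.*-monoˡ-≤ _ (ℕ.*-monoʳ-≤ 2 (ℕ.m≤m*n N N)) ⟩
        2 * (N * N) * (7 * (d * d) + 7 * (d * d))      ≡⟨ spread 2 7 (d * d) (N * N) ⟩
        2 * (7 + 7) * (d * d * (N * N))                ∎
        where
        spread : ∀ a b x y → a * y * (b * x + b * x) ≡ a * (b + b) * (x * y)
        spread = NatSolver.solve 4 (λ a b x y → a ⊗ y ⊗ (b ⊗ x ⊕ b ⊗ x) ⊜ a ⊗ (b ⊕ b) ⊗ (x ⊗ y)) refl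
      pointCost≤ : d + suc d ≤ 3 * d
      pointCost≤ = begin
        d + (1 + d)          ≤⟨ ℕ.+-monoʳ-≤ d (ℕ.+-monoˡ-≤ d 1≤d) ⟩
        d + (d + d)          ≡⟨ cong (λ x → d + (d + x)) (ℕ.+-identityʳ d) ⟨
        3 * d                ∎
      -- The rounded logarithm is at least 1 because d + 1 ≥ 2.
      d³≤ : d ^ 3 ≤ d ^ 3 * ⌊log₂ (d + 1) ⌋
      d³≤ = begin
        d ^ 3                        ≡⟨ ℕ.*-identityʳ (d ^ 3) ⟨
        d ^ 3 * 1                    ≤⟨ ℕ.*-monoʳ-≤ (d ^ 3) (ℕ.≤-trans (ℕ.≤-reflexive (sym (⌊log₂[2^n]⌋≡n 1)))
                                          (⌊log₂⌋-mono-≤ (ℕ.+-monoˡ-≤ 1 1≤d))) ⟩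
        d ^ 3 * ⌊log₂ (d + 1) ⌋      ∎

  -- An empty matrix has no position to draw and gets a fixed answer; correctness is claimed for
  -- nonempty matrices.
  algorithm : ∀ n m → Algorithm n m
  algorithm zero    _       = output true
  algorithm (suc n) zero    = output true
  algorithm (suc n) (suc m) = Tester.tester (verdict d κ) S P d

  module _ (ε : ℝ) (1/N<ε : (+ 1 / N) ℚ<ℝ ε) (ε≤3/N : ∀ r → r ℚ<ℝ ε → r ℚ.* ι N ℚ.≤ ι 3) where

    algorithm-correct : ∀ n m .{{_ : NonZero n}} .{{_ : NonZero m}} (M : Matrix n m) →
      (queries (algorithm n m) M ≤ 9 * queryConstant * (d ^ 3 * ⌊log₂ (d + 1) ⌋) /[ ε ]²)
      × (BinaryRankAtMost d M → (+ 2 / 3) ℚ≤ Pr[ algorithm n m accepts M ])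
      × (M IsFarFromBinaryRankAtMost d [ ε ] → (+ 2 / 3) ℚ≤ Pr[ algorithm n m rejects M ])
    algorithm-correct zero    m       M = ⊥-elim (ℕ.≢-nonZero⁻¹ 0 refl)
    algorithm-correct (suc n) zero    M = ⊥-elim (ℕ.≢-nonZero⁻¹ 0 refl)
    algorithm-correct (suc n) (suc m) M =
      cheap , accepts , rejects
      where
      T = algorithm (suc n) (suc m)
      cheap : queries T M ≤ 9 * queryConstant * (d ^ 3 * ⌊log₂ (d + 1) ⌋) /[ ε ]²
      cheap = scale-bound ε N ε≤3/N {K = queryConstant} {b = d ^ 3 * ⌊log₂ (d + 1) ⌋}
        (ℕ.≤-trans (Tester.queries-tester (verdict d κ) S M d P) queries≤)
      rarelyRejects : BooleanFactorization M d → Pr[ T rejects M ] ℚ.≤ + 1 / 3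
      rarelyRejects (A , B , AB≡M) = tester-complete M d N κ A B AB≡M
      accepts : BinaryRankAtMost d M → (+ 2 / 3) ℚ≤ Pr[ T accepts M ]
      accepts rank≤d = 2/3≤complement (Pr-total M T) (rarelyRejects (binaryRank⇒factorization M rank≤d))
      rejects : M IsFarFromBinaryRankAtMost d [ ε ] → (+ 2 / 3) ℚ≤ Pr[ T rejects M ]
      rejects far = 2/3≤complement (trans (ℚ.+-comm Pr[ T rejects M ] Pr[ T accepts M ]) (Pr-total M T))
        (Tester.tester-accepts≤ (verdict d κ) S M d (1/≥0 3)
          (λ st r≤d → test-sound M d N L st (hypotheses-size r≤d) λ h → far⇒missProbability M st h {ε} N 1/N<ε far) P)

theorem2 : Σ[ C ∈ ℕ ] (∀ (d : ℕ) → 1 ≤ d → ∀ (ε : ℝ) → 0ℚ ℚ<ℝ ε → ε ℝ≤ℚ 1ℚ →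
    Σ[ T ∈ (∀ n m → Algorithm n m) ]
    (∀ (n m : ℕ) .{{_ : NonZero n}} .{{_ : NonZero m}} (M : Matrix n m) →
    (queries (T n m) M ≤ C * (d ^ 3 * ⌊log₂ (d + 1) ⌋) /[ ε ]²)
    × (BinaryRankAtMost d M → (+ 2 / 3) ℚ≤ Pr[ T n m accepts M ])
    × (M IsFarFromBinaryRankAtMost d [ ε ] → (+ 2 / 3) ℚ≤ Pr[ T n m rejects M ])))
theorem2 = 9 * queryConstant , λ d 1≤d ε 0<ε ε≤1 → main d {{ℕ.>-nonZero 1≤d}} ε (scale ε 0<ε ε≤1)
  where
  main : ∀ d .{{_ : NonZero d}} (ε : ℝ) → Scale ε → _
  main d ε (N , N≢0 , 1/N<ε , ε≤3/N) = P.algorithm , P.algorithm-correct ε 1/N<ε ε≤3/N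
    where
    module P = Parameters d N {{it}} {{N≢0}}
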